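{- Let $n$ and $h$ be positive integers and put $m=\operatorname{lcm}(n,h)$. If a $\mathrm{BH}(\mathbb{Z}_n,h)$ matrix exists, then every prime divisor of $n$ which is self-conjugate modulo $m$ divides $h$.
   Context: For a finite abelian group $(G,+)$ and a positive integer $h$, a $\mathrm{BH}(G,h)$ matrix is a $|G|\times|G|$ matrix $H=(a_{g,k})_{g,k\in G}$ whose entries are complex $h$th roots of unity, which is $G$-invariant (i.e. $a_{g+l,k+l}=a_{g,k}$ for all $g,k,l\in G$), and satisfies $HH^*=|G|I$. $\mathbb{Z}_n$ is the cyclic group of order $n$. A prime $p$ is self-conjugate modulo a positive integer $N$ if, writing $N=p^aN'$ with $\gcd(p,N')=1$, there is an integer $j$ with $p^j\equiv -1\pmod{N'}$. -}

module Defs where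

open import Level using (_⊔_)
open import Data.Nat as ℕ using (ℕ; zero; suc; NonZero)
open import Data.Nat.DivMod using (_%_; m%n<n)
open import Data.Nat.Divisibility using (_∣_)
open import Data.Nat.Coprimality using (Coprime)
open import Data.Fin using (Fin; toℕ; fromℕ<)
import Data.Fin as Fin
open import Data.Product using (∃; ∃-syntax; _×_)
open import Data.Sum using (_⊎_)
open import Relation.Binary.PropositionalEquality using (_≡_; _≢_)
open import Relation.Nullary using (¬_)
open import Algebra.Bundles using (CommutativeRing)

_⊕_ : ∀ {n} .{{_ : NonZero n}} → Fin n → Fin n → Fin n
_⊕_ {n} a b = fromℕ< (m%n<n (toℕ a ℕ.+ toℕ b) n)

SelfConjugate : ℕ → ℕ → Set
SelfConjugate p N =
  ∃[ a ] ∃[ N' ] (N ≡ p ℕ.^ a ℕ.* N') × Coprime p N' × (∃[ j ] (N' ∣ p ℕ.^ j ℕ.+ 1))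

module _ {c ℓ} (R : CommutativeRing c ℓ) where
  open CommutativeRing R

  pow : Carrier → ℕ → Carrier
  pow x zero    = 1#
  pow x (suc k) = x * pow x k

  natR : ℕ → Carrier
  natR zero    = 0#
  natR (suc k) = 1# + natR k

  sumFin : ∀ {n} → (Fin n → Carrier) → Carrier
  sumFin {zero}  f = 0#
  sumFin {suc n} f = f Fin.zero + sumFin (λ i → f (Fin.suc i))

  -- R is an integral domain of characteristic zero
  -- (it then embeds, on its roots of unity, into ℂ up to Galois conjugation).
  record IsChar0Domain : Set (c ⊔ ℓ) where
    field
      nontrivial : ¬ (1# ≈ 0#)
      noZeroDivisors : ∀ x y → x * y ≈ 0# → x ≈ 0# ⊎ y ≈ 0#
      char0 : ∀ k → natR k ≈ 0# → k ≡ 0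

  -- A BH(ℤ_n, h) matrix with entries in R: entries are h-th roots of unity,
  -- ℤ_n-invariant, and H H* = n I, where the conjugate of an h-th root of
  -- unity x is x^(h-1) = x⁻¹.
  record BH (n h : ℕ) .{{_ : NonZero n}} : Set (c ⊔ ℓ) where
    field
      H : Fin n → Fin n → Carrier
      root : ∀ g k → pow (H g k) h ≈ 1#
      invariant : ∀ g k l → H (g ⊕ l) (k ⊕ l) ≈ H g k
      orth-diag : ∀ g → sumFin (λ k → H g k * pow (H g k) (h ℕ.∸ 1)) ≈ natR n
      orth-off : ∀ g g' → g ≢ g' → sumFin (λ k → H g k * pow (H g' k) (h ℕ.∸ 1)) ≈ 0#

{-# OPTIONS --safe #-}

-- Let a be the first row of H and suppose p ∤ h.  Work in the ring Q = ℤ[a] / pℤ[a] and write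
-- n = P n′ with P = p^(b+1) and p ∤ n′.  By self-conjugacy there is a power q of p divisible by P
-- with q ≡ -1 modulo n′ and h, so φ(x) = x^q inverts the entries of a, and φ² is the identity of Q.
-- The row gives D in the group ring Q[X]/(X^n - 1) with D D* = 0, where * inverts X and applies φ
-- to coefficients.  With s = X^n′ - 1 one has s^P = 0, every E satisfies E* ≡ E^q and
-- E^(q²) ≡ E modulo s, and s^(P-1) E^(q²) = 0 forces E^(q²) = 0.  Hence D = s^i E with 2i < P
-- implies that s^(i+1) divides D, so s^i divides D as long as 2i ≤ P.
-- Consequently the difference operator Δ of step n/p satisfies Δ^⌈p/2⌉ a = 0 in Q.  If
-- Δ^(d+1) a = 0 with 0 < 2d < p, then the Leibniz rule applied to a φ(a) = 1 gives
-- C(2d,d) (Δ^d a) φ(Δ^d a) = 0, so Δ^d a = 0; therefore Δ a = 0 in Q.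
-- Distinct h-th roots of unity stay distinct in Q because p is not a unit in ℤ[a], so two
-- different rows of H coincide, contradicting orthogonality.
module Submission where

open import Defs
open import Algebra.Bundles using (CommutativeRing)
open import Data.Bool using (if_then_else_)
open import Data.Empty using (⊥; ⊥-elim)
open import Data.Fin as Fin using (Fin; toℕ; fromℕ<)
import Data.Fin.Properties as Fin
open import Data.List using (List; []; _∷_; tabulate)
open import Data.List.Membership.Propositional using (_∈_)
open import Data.List.Membership.Propositional.Properties using (∈-tabulate⁺)
open import Data.List.Relation.Unary.All as All using (All; []; _∷_)
import Data.List.Relation.Unary.All.Properties as All
open import Data.List.Relation.Unary.Any using (here; there)
open import Data.Nat as ℕ using (ℕ; zero; suc; NonZero; _∸_; _!; s≤s; z≤n; ⌊_/2⌋; ⌈_/2⌉)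
open import Data.Nat.Combinatorics using (_C_; nCk≡n!/k![n-k]!; k![n∸k]!∣n!; nCn≡1; nCk≡nC[n∸k]; nCk+nC[k+1]≡[n+1]C[k+1])
open import Data.Nat.Coprimality as Coprime using (Coprime; coprime-Bézout; coprime-divisor)
open import Data.Nat.DivMod
  using (_%_; _/_; m/n*n≡m; m%n<n; m≡m%n+[m/n]*n; m<n⇒m%n≡m; %-distribˡ-+; m%n%n≡m%n; [m+n]%n≡m%n; [m+kn]%n≡m%n)
open import Data.Nat.Divisibility
open import Data.Nat.GCD using (module Bézout)
open import Data.Nat.Induction using (<-rec)
open import Data.Nat.LCM using (lcm; m∣lcm[m,n]; n∣lcm[m,n])
open import Data.Nat.Primality using (Prime; euclidsLemma; prime⇒irreducible; prime⇒nonTrivial; prime⇒nonZero)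
open import Data.Nat.Properties as ℕ using ()
open import Data.Nat.Tactic.RingSolver using (solve-∀)
open import Data.Product using (Σ; ∃-syntax; _,_; proj₁; proj₂) renaming (_×_ to _∧_)
open import Data.Sum using (_⊎_; inj₁; inj₂; [_,_]′)
open import Level using (_⊔_)
open import Relation.Binary.PropositionalEquality as ≡ using (_≡_; _≢_)
open import Relation.Nullary using (¬_; does; yes; no)

-- Frobenius

-- No prime ideal above p is chosen, so `Q` need not be a field. What a field would supply is
-- reducedness, and this comes from φ: since q is at least 2, e φ(e) divides φ²(e), so e φ(e) = 0
-- forces e = 0 wherever φ² is the identity. The group ring is not reduced, as s is nilpotent, and
-- there φ² is the identity only modulo s; the descent exploits this gap. Because s* is a unit times
-- s, D D* = 0 becomes s^(2i) E E* = 0, and this can be raised to s^(P-1) E E^q = 0 only while 2i <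
-- P. The descent therefore stops near P/2 and shows merely that a behaves like a polynomial of
-- degree below p/2 under Δ. In that range C(2d,d) is prime to p, which is what lets the relation a
-- φ(a) = 1 remove the remaining degree. Reduction modulo p takes place in ℤ[a] because p may well
-- be invertible in R.

prime∤! : ∀ {p} → Prime p → ∀ n → n ℕ.< p → ¬ p ∣ n !
prime∤! pp zero    n<p p∣1 = ℕ.<⇒≱ (ℕ.nonTrivial⇒n>1 _ {{prime⇒nonTrivial pp}}) (∣⇒≤ p∣1)
prime∤! pp (suc n) n<p p∣n! with euclidsLemma (suc n) (n !) pp p∣n!
... | inj₁ p∣sn = ℕ.<⇒≱ n<p (∣⇒≤ p∣sn)
... | inj₂ p∣n! = prime∤! pp n (ℕ.<⇒≤ n<p) p∣n!

C*k![n∸k]!≡n! : ∀ {n k} → k ℕ.≤ n → (n C k) ℕ.* (k ! ℕ.* (n ∸ k) !) ≡ n !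
C*k![n∸k]!≡n! {n} {k} k≤n = ≡.trans
  (≡.cong (ℕ._* (k ! ℕ.* (n ∸ k) !)) (nCk≡n!/k![n-k]! k≤n))
  (m/n*n≡m {{k ℕ.!* (n ∸ k) !≢0}} (k![n∸k]!∣n! k≤n))

prime∣C : ∀ {p} → Prime p → ∀ k → 0 ℕ.< k → k ℕ.< p → p ∣ p C k
prime∣C {p@(suc p-1)} pp k 0<k k<p
  with euclidsLemma (p C k) (k ! ℕ.* (p ∸ k) !) pp
         (≡.subst (p ∣_) (≡.sym (C*k![n∸k]!≡n! (ℕ.<⇒≤ k<p))) (m∣m*n (p-1 !)))
... | inj₁ d = d
... | inj₂ d with euclidsLemma (k !) ((p ∸ k) !) pp d
...   | inj₁ d′ = ⊥-elim (prime∤! pp k k<p d′)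
...   | inj₂ d′ = ⊥-elim (prime∤! pp (p ∸ k) (ℕ.∸-monoʳ-< 0<k (ℕ.<⇒≤ k<p)) d′)
prime∣C {zero} pp _ _ ()

prime∤C : ∀ {p} → Prime p → ∀ n k → k ℕ.≤ n → n ℕ.< p → ¬ p ∣ n C k
prime∤C {p} pp n k k≤n n<p (divides m eq) = prime∤! pp n n<p
  (≡.subst (p ∣_) (≡.trans (≡.cong (ℕ._* (k ! ℕ.* (n ∸ k) !)) (≡.sym eq)) (C*k![n∸k]!≡n! k≤n))
    (divides (m ℕ.* (k ! ℕ.* (n ∸ k) !)) comm))
  where
  F = k ! ℕ.* (n ∸ k) !
  comm : m ℕ.* p ℕ.* F ≡ m ℕ.* F ℕ.* p
  comm = ≡.trans (ℕ.*-assoc m p F) (≡.trans (≡.cong (m ℕ.*_) (ℕ.*-comm p F)) (≡.sym (ℕ.*-assoc m F p)))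

-- Ring identities with a formal -1

module RingLemmas {c ℓ} (R : CommutativeRing c ℓ) where
  open CommutativeRing R
  open import Algebra.Properties.Ring ring public using (-1*x≈-x; +-cancelˡ)
  open import Algebra.Properties.Semiring.Mult semiring public
  open import Algebra.Properties.CommutativeSemiring.Exp commutativeSemiring public
  open import Algebra.Solver.Ring.NaturalCoefficients.Default commutativeSemiring public
    using (solve; _:=_; _:+_; _:*_)
  open import Algebra.Properties.Ring ring using (-‿involutive)
  open import Relation.Binary.Reasoning.Setoid setoid

  -- An opaque constant for -1: identities with signs become semiring identities in one more
  -- indeterminate, up to summands of the form x + ε x.
  ε : Carrier
  ε = - 1#

  1+ε≈0 : 1# + ε ≈ 0#
  1+ε≈0 = -‿inverseʳ 1#

  HasCharacteristic : ℕ → Set ℓ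
  HasCharacteristic p = p × 1# ≈ 0#

  IsRootOfUnity : ℕ → Carrier → Set ℓ
  IsRootOfUnity m x = x ^ m ≈ 1#

  ε*ε≈1 : ε * ε ≈ 1#
  ε*ε≈1 = trans (-1*x≈-x ε) (-‿involutive 1#)

  +-zero : ∀ {x y} → x ≈ 0# → y ≈ 0# → x + y ≈ 0#
  +-zero x≈0 y≈0 = trans (+-cong x≈0 y≈0) (+-identityˡ 0#)

  *-zeroʳ : ∀ x {y} → y ≈ 0# → x * y ≈ 0#
  *-zeroʳ x y≈0 = trans (*-congˡ y≈0) (zeroʳ x)

  *-zeroˡ : ∀ {x} y → x ≈ 0# → x * y ≈ 0#
  *-zeroˡ y x≈0 = trans (*-congʳ x≈0) (zeroˡ y)

  x+εx≈0 : ∀ x → x + ε * x ≈ 0#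
  x+εx≈0 x = begin
    x + ε * x      ≈⟨ +-congʳ (*-identityˡ x) ⟨
    1# * x + ε * x ≈⟨ distribʳ x 1# ε ⟨
    (1# + ε) * x   ≈⟨ *-zeroˡ x 1+ε≈0 ⟩
    0#             ∎

  x≈y+d⇒y≈x+εd : ∀ {x y d} → x ≈ y + d → y ≈ x + ε * d
  x≈y+d⇒y≈x+εd {x} {y} {d} eq = begin
    y               ≈⟨ +-identityʳ y ⟨
    y + 0#          ≈⟨ +-congˡ (x+εx≈0 d) ⟨
    y + (d + ε * d) ≈⟨ +-assoc _ _ _ ⟨
    y + d + ε * d   ≈⟨ +-congʳ eq ⟨
    x + ε * d       ∎

  x+εy≈0⇒x≈y : ∀ {x y} → x + ε * y ≈ 0# → x ≈ y
  x+εy≈0⇒x≈y {x} {y} eq = begin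
    x               ≈⟨ +-identityʳ x ⟨
    x + 0#          ≈⟨ +-congˡ (x+εx≈0 y) ⟨
    x + (y + ε * y) ≈⟨ solve 3 (λ x y z → x :+ (y :+ z) := (x :+ z) :+ y) refl x y (ε * y) ⟩
    x + ε * y + y   ≈⟨ +-congʳ eq ⟩
    0# + y          ≈⟨ +-identityˡ y ⟩
    y               ∎

  +-zeroˡ⁻ : ∀ {x y} → x ≈ 0# → x + y ≈ 0# → y ≈ 0#
  +-zeroˡ⁻ {x} {y} x≈0 eq = trans (sym (+-identityˡ y)) (trans (+-congʳ (sym x≈0)) eq)

  1^n≈1 : ∀ n → 1# ^ n ≈ 1#
  1^n≈1 zero    = refl
  1^n≈1 (suc n) = trans (*-identityˡ _) (1^n≈1 n)

  ^-swap : ∀ x m n → (x ^ m) ^ n ≈ (x ^ n) ^ m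
  ^-swap x m n = trans (^-assocʳ x m n) (trans (^-congʳ x (ℕ.*-comm m n)) (sym (^-assocʳ x n m)))

  inv-^ : ∀ {x y} → x * y ≈ 1# → ∀ n → x ^ n * y ^ n ≈ 1#
  inv-^ {x} {y} xy≈1 n = trans (sym (^-distrib-* x y n)) (trans (^-congˡ n xy≈1) (1^n≈1 n))

  ×-zeroʳ : ∀ n {x} → x ≈ 0# → n × x ≈ 0#
  ×-zeroʳ zero    x≈0 = refl
  ×-zeroʳ (suc n) x≈0 = +-zero x≈0 (×-zeroʳ n x≈0)

  ∣-×-zero : ∀ {m n x} → m ∣ n → m × x ≈ 0# → n × x ≈ 0#
  ∣-×-zero {m} {n} {x} (divides k ≡.refl) mx≈0 = trans (sym (×-assocˡ x k m)) (×-zeroʳ k mx≈0)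

  coprime-×-zero : ∀ {m n} x → Coprime m n → m × x ≈ 0# → n × x ≈ 0# → x ≈ 0#
  coprime-×-zero {m} {n} x cop mx nx with coprime-Bézout cop
  ... | Bézout.+- i j eq = trans (sym (+-identityʳ x)) (trans (+-congˡ (sym (∣-×-zero (divides j ≡.refl) nx)))
          (trans (×-congˡ eq) (∣-×-zero (divides i ≡.refl) mx)))
  ... | Bézout.-+ i j eq = trans (sym (+-identityʳ x)) (trans (+-congˡ (sym (∣-×-zero (divides i ≡.refl) mx)))
          (trans (×-congˡ eq) (∣-×-zero (divides j ≡.refl) nx)))

  geometric : Carrier → ℕ → Carrier
  geometric x zero    = 0#
  geometric x (suc k) = 1# + x * geometric x k

  -- With x = ξ^n′ this says that exponents congruent modulo n′ give equal powers of ξ modulo s. The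
  -- cofactor is explicit because the descent has to write it as a term.
  geometric-sum : ∀ x k → x ^ k ≈ 1# + (x + ε) * geometric x k
  geometric-sum x zero    = sym (trans (+-congˡ (zeroʳ _)) (+-identityʳ 1#))
  geometric-sum x (suc k) = begin
    x * x ^ k                              ≈⟨ *-congˡ (geometric-sum x k) ⟩
    x * (1# + (x + ε) * g)                 ≈⟨ +-identityˡ _ ⟨
    0# + x * (1# + (x + ε) * g)            ≈⟨ +-congʳ 1+ε≈0 ⟨
    1# + ε + x * (1# + (x + ε) * g)        ≈⟨ +-cong (+-congˡ (sym (*-identityʳ ε))) (distribˡ x 1# _) ⟩
    1# + ε * 1# + (x * 1# + x * ((x + ε) * g))
     
       ≈⟨ solve 4 (λ x e g o → o :+ e :* o :+ (x :* o :+ x :* ((x :+ e) :* g)) := o :+ (x :+ e) :* (o :+ x :* g)) refl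
            x ε g 1# ⟩
    1# + (x + ε) * (1# + x * g)            ∎
    where g = geometric x k

module Frobenius {c ℓ} (R : CommutativeRing c ℓ) {p : ℕ} (p-prime : Prime p) where
  open CommutativeRing R
  open RingLemmas R
  open import Algebra.Properties.CommutativeSemiring.Binomial commutativeSemiring
  open import Algebra.Properties.Semiring.Sum semiring
  open import Relation.Binary.Reasoning.Setoid setoid

  module _ (p×1≈0 : p × 1# ≈ 0#) where

    p×x≈0 : ∀ x → p × x ≈ 0#
    p×x≈0 x = begin
      p × x          ≈⟨ ×-congʳ p (*-identityˡ x) ⟨
      p × (1# * x)   ≈⟨ ×-assoc-* p 1# x ⟨
      (p × 1#) * x   ≈⟨ *-zeroˡ x p×1≈0 ⟩
      0#             ∎

    sum-zero : ∀ {n} (f : Fin n → Carrier) → (∀ i → f i ≈ 0#) → sum f ≈ 0#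
    sum-zero {zero}  f f≈0 = refl
    sum-zero {suc n} f f≈0 = +-zero (f≈0 Fin.zero) (sum-zero _ λ i → f≈0 (Fin.suc i))

    freshman′ : ∀ x y k → p ≡ suc k → (x + y) ^ suc k ≈ x ^ suc k + y ^ suc k
    freshman′ x y k eq = begin
      (x + y) ^ suc k                  ≈⟨ theorem (suc k) x y ⟩
      t Fin.zero + sum (λ i → t (Fin.suc i))
        ≈⟨ +-cong (trans (×-homo-1 _) (*-identityˡ _)) (sum-init-last {k} (λ i → t (Fin.suc i))) ⟩
      y ^ suc k + (sum (λ i → t (Fin.suc (Fin.inject₁ i))) + t (Fin.suc (Fin.fromℕ k)))
        ≈⟨ +-congˡ (+-congʳ (sum-zero _ middle)) ⟩
      y ^ suc k + (0# + t (Fin.suc (Fin.fromℕ k)))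
        ≈⟨ +-congˡ (trans (+-identityˡ _) last-term) ⟩
      y ^ suc k + x ^ suc k            ≈⟨ +-comm _ _ ⟩
      x ^ suc k + y ^ suc k            ∎
      where
      t = binomialTerm x y (suc k)
      middle : ∀ i → t (Fin.suc (Fin.inject₁ i)) ≈ 0#
      middle i = ∣-×-zero
        (≡.subst (_∣ (suc k C toℕ (Fin.suc (Fin.inject₁ i)))) (≡.sym eq)
          (prime∣C (≡.subst Prime eq p-prime) (suc (toℕ (Fin.inject₁ i))) (s≤s z≤n)
            (s≤s (≡.subst (ℕ._< k) (≡.sym (Fin.toℕ-inject₁ i)) (Fin.toℕ<n i)))))
        (p×x≈0 _)
      last-term : t (Fin.suc (Fin.fromℕ k)) ≈ x ^ suc k
      last-term rewrite Fin.toℕ-fromℕ k | nCn≡1 (suc k) | ℕ.n∸n≡0 k = trans (×-homo-1 _) (*-identityʳ _)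

    freshman : ∀ x y → (x + y) ^ p ≈ x ^ p + y ^ p
    freshman x y = ≡.subst (λ m → (x + y) ^ m ≈ x ^ m + y ^ m) (≡.sym p≡) (freshman′ x y (ℕ.pred p) p≡)
      where p≡ = ≡.sym (ℕ.suc-pred p {{prime⇒nonZero p-prime}})

    frobenius-+ : ∀ j x y → (x + y) ^ (p ℕ.^ j) ≈ x ^ (p ℕ.^ j) + y ^ (p ℕ.^ j)
    frobenius-+ zero    x y = trans (*-identityʳ _) (+-cong (sym (*-identityʳ x)) (sym (*-identityʳ y)))
    frobenius-+ (suc j) x y = begin
      (x + y) ^ (p ℕ.* r)             ≈⟨ ^-assocʳ (x + y) p r ⟨
      ((x + y) ^ p) ^ r               ≈⟨ ^-congˡ r (freshman x y) ⟩
      (x ^ p + y ^ p) ^ r             ≈⟨ frobenius-+ j _ _ ⟩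
      (x ^ p) ^ r + (y ^ p) ^ r       ≈⟨ +-cong (^-assocʳ x p r) (^-assocʳ y p r) ⟩
      x ^ (p ℕ.* r) + y ^ (p ℕ.* r)   ∎
      where r = p ℕ.^ j

    0^q≈0 : ∀ j {x} → x ≈ 0# → x ^ (p ℕ.^ j) ≈ 0#
    0^q≈0 j {x} x≈0 with p ℕ.^ j in eq
    ... | zero  = ⊥-elim (ℕ.≢-nonZero⁻¹ _ {{ℕ.m^n≢0 p j {{prime⇒nonZero p-prime}}}} eq)
    ... | suc r = *-zeroˡ _ x≈0

    -- Read off from additivity of the Frobenius map at 1 + ε = 0, which treats p = 2 and odd p
    -- alike.
    ε^q≈ε : ∀ j → ε ^ (p ℕ.^ j) ≈ ε
    ε^q≈ε j = +-cancelˡ 1# _ _ (begin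
      1# + ε ^ q       ≈⟨ +-congʳ (1^n≈1 q) ⟨
      1# ^ q + ε ^ q   ≈⟨ frobenius-+ j 1# ε ⟨
      (1# + ε) ^ q     ≈⟨ 0^q≈0 j 1+ε≈0 ⟩
      0#               ≈⟨ 1+ε≈0 ⟨
      1# + ε           ∎)
      where q = p ℕ.^ j

-- Descent along powers of s

infixl 6 _⊞_
infixl 7 _⊠_

-- Expressions rather than ring elements: D and D* are one expression under two evaluations, so
-- conjugation never has to be shown compatible with equality, and a cofactor found by recursion
-- serves both evaluations. Signs come from a constant for -1.
data Term {c} (C : Set c) : Set c where
  con     : C → Term C
  var     : Term C
  _⊞_ _⊠_ : Term C → Term C → Term C

module Evaluation {b ℓ c} (B : CommutativeRing b ℓ) {C : Set c}
  (σ : C → CommutativeRing.Carrier B) (ξ : CommutativeRing.Carrier B) where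
  open CommutativeRing B

  ⟦_⟧ : Term C → Carrier
  ⟦ con x ⟧ = σ x
  ⟦ var ⟧   = ξ
  ⟦ E ⊞ F ⟧ = ⟦ E ⟧ + ⟦ F ⟧
  ⟦ E ⊠ F ⟧ = ⟦ E ⟧ * ⟦ F ⟧

module Constructions {c} {C : Set c} (O I : C) (q n′ k : ℕ) where

  varPower : ℕ → Term C
  varPower zero    = con I
  varPower (suc m) = var ⊠ varPower m

  geometricTerm : ℕ → Term C
  geometricTerm zero    = con O
  geometricTerm (suc m) = con I ⊞ varPower n′ ⊠ geometricTerm m

  -- The q²-th power when φ² fixes the constants: by additivity only `var` changes. As a term it
  -- shows that only exponents divisible by q² occur, and it keeps the cofactor of a product a term.
  frobeniusTerm : Term C → Term C
  frobeniusTerm (con x) = con x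
  frobeniusTerm var     = varPower (q ℕ.* q)
  frobeniusTerm (E ⊞ F) = frobeniusTerm E ⊞ frobeniusTerm F
  frobeniusTerm (E ⊠ F) = frobeniusTerm E ⊠ frobeniusTerm F

  -- q² = 1 + n′k, so ξ^(q²) - ξ is divisible by ξ^n′ - 1; quotientTerm E is (E^(q²) - E) / (ξ^n′ - 1).
  quotientTerm : Term C → Term C
  quotientTerm (con x) = con O
  quotientTerm var     = var ⊠ geometricTerm k
  quotientTerm (E ⊞ F) = quotientTerm E ⊞ quotientTerm F
  quotientTerm (E ⊠ F) = quotientTerm E ⊠ F ⊞ frobeniusTerm E ⊠ quotientTerm F

module CharP {r ℓ} (B : CommutativeRing r ℓ) {p : ℕ} (p-prime : Prime p) (j : ℕ)
  (p×1≈0 : RingLemmas.HasCharacteristic B p) where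
  open CommutativeRing B
  open RingLemmas B
  open Frobenius B p-prime

  q : ℕ
  q = p ℕ.^ j

  φ : Carrier → Carrier
  φ x = x ^ q

  φ-cong : ∀ {x y} → x ≈ y → φ x ≈ φ y
  φ-cong = ^-congˡ q

  φ-+ : ∀ x y → φ (x + y) ≈ φ x + φ y
  φ-+ = frobenius-+ p×1≈0 j

  φ-* : ∀ x y → φ (x * y) ≈ φ x * φ y
  φ-* x y = ^-distrib-* x y q

  φ-0 : ∀ {x} → x ≈ 0# → φ x ≈ 0#
  φ-0 = 0^q≈0 p×1≈0 j

  φφ-cong : ∀ {x y} → x ≈ y → φ (φ x) ≈ φ (φ y)
  φφ-cong eq = φ-cong (φ-cong eq)

  φφ-+ : ∀ x y → φ (φ (x + y)) ≈ φ (φ x) + φ (φ y)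
  φφ-+ x y = trans (φ-cong (φ-+ x y)) (φ-+ _ _)

  φφ-* : ∀ x y → φ (φ (x * y)) ≈ φ (φ x) * φ (φ y)
  φφ-* x y = trans (φ-cong (φ-* x y)) (φ-* _ _)

  -- As q is at least 2, φ(φ(e)) contains φ(e) twice, and one of the two copies contains e; hence e
  -- φ(e) divides φ(φ(e)).
  zero-φφ : ∀ r x e → q ≡ suc (suc r) → x * (e * φ e) ≈ 0# → x * φ (φ e) ≈ 0#
  zero-φφ r x e q≡ eq = begin
    x * φ (φ e)                                ≈⟨ *-congˡ (^-congʳ (φ e) q≡) ⟩
    x * (φ e * (φ e * φ e ^ r))                ≈⟨ *-congˡ (*-congʳ (^-congʳ e q≡)) ⟩
    x * (e * e ^ suc r * (φ e * φ e ^ r))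
     
       ≈⟨ solve 5 (λ x e u v w → x :* (e :* u :* (v :* w)) := x :* (e :* v) :* (u :* w)) refl
            x e (e ^ suc r) (φ e) (φ e ^ r) ⟩
    x * (e * φ e) * (e ^ suc r * φ e ^ r)      ≈⟨ *-zeroˡ _ eq ⟩
    0#                                         ∎
    where
    open import Relation.Binary.Reasoning.Setoid setoid

  module Reduction {c} {C : Set c} (O I : C) (σ : C → Carrier) (ξ : Carrier)
    (σO : σ O ≈ 0#) (σI : σ I ≈ 1#) (φφσ : ∀ x → φ (φ (σ x)) ≈ σ x)
    (n′ k : ℕ) (qq≡ : q ℕ.* q ≡ suc (n′ ℕ.* k)) where
    open Evaluation B σ ξ
    open Constructions O I q n′ k
    open import Relation.Binary.Reasoning.Setoid setoid

    s : Carrier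
    s = ξ ^ n′ + ε

    eval-varPower : ∀ m → ⟦ varPower m ⟧ ≈ ξ ^ m
    eval-varPower zero    = σI
    eval-varPower (suc m) = *-congˡ (eval-varPower m)

    eval-geometricTerm : ∀ m → ⟦ geometricTerm m ⟧ ≈ geometric (ξ ^ n′) m
    eval-geometricTerm zero    = σO
    eval-geometricTerm (suc m) = +-cong σI (*-cong (eval-varPower n′) (eval-geometricTerm m))

    eval-frobeniusTerm : ∀ E → φ (φ ⟦ E ⟧) ≈ ⟦ frobeniusTerm E ⟧
    eval-frobeniusTerm (con x) = φφσ x
    eval-frobeniusTerm var     = trans (^-assocʳ ξ q q) (sym (eval-varPower (q ℕ.* q)))
    eval-frobeniusTerm (E ⊞ F) = trans (φφ-+ _ _) (+-cong (eval-frobeniusTerm E) (eval-frobeniusTerm F))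
    eval-frobeniusTerm (E ⊠ F) = trans (φφ-* _ _) (*-cong (eval-frobeniusTerm E) (eval-frobeniusTerm F))

    eval-quotientTerm : ∀ E → φ (φ ⟦ E ⟧) ≈ ⟦ E ⟧ + s * ⟦ quotientTerm E ⟧
    eval-quotientTerm (con x) = trans (φφσ x) (sym (trans (+-congˡ (*-zeroʳ s σO)) (+-identityʳ _)))
    eval-quotientTerm var     = begin
      φ (φ ξ)                            ≈⟨ ^-assocʳ ξ q q ⟩
      ξ ^ (q ℕ.* q)                      ≈⟨ ^-congʳ ξ qq≡ ⟩
      ξ * ξ ^ (n′ ℕ.* k)                 ≈⟨ *-congˡ (^-assocʳ ξ n′ k) ⟨
      ξ * (ξ ^ n′) ^ k                   ≈⟨ *-congˡ (geometric-sum (ξ ^ n′) k) ⟩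
      ξ * (1# + s * g)                   ≈⟨ distribˡ ξ 1# _ ⟩
      ξ * 1# + ξ * (s * g)
        ≈⟨ +-cong (*-identityʳ ξ) (solve 3 (λ a b c → a :* (b :* c) := b :* (a :* c)) refl ξ s g) ⟩
      ξ + s * (ξ * g)                    ≈⟨ +-congˡ (*-congˡ (*-congˡ (eval-geometricTerm k))) ⟨
      ξ + s * (ξ * ⟦ geometricTerm k ⟧)  ∎
      where g = geometric (ξ ^ n′) k
    eval-quotientTerm (E ⊞ F) = begin
      φ (φ (⟦ E ⟧ + ⟦ F ⟧))                     ≈⟨ φφ-+ _ _ ⟩
      φ (φ ⟦ E ⟧) + φ (φ ⟦ F ⟧)                 ≈⟨ +-cong (eval-quotientTerm E) (eval-quotientTerm F) ⟩
      (⟦ E ⟧ + s * ⟦ quotientTerm E ⟧) + (⟦ F ⟧ + s * ⟦ quotientTerm F ⟧)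
        ≈⟨ solve 5 (λ e f s a b → (e :+ s :* a) :+ (f :+ s :* b) := (e :+ f) :+ s :* (a :+ b)) refl
             ⟦ E ⟧ ⟦ F ⟧ s ⟦ quotientTerm E ⟧ ⟦ quotientTerm F ⟧ ⟩
      ⟦ E ⊞ F ⟧ + s * ⟦ quotientTerm (E ⊞ F) ⟧      ∎
    eval-quotientTerm (E ⊠ F) = begin
      φ (φ (⟦ E ⟧ * ⟦ F ⟧))                     ≈⟨ φφ-* _ _ ⟩
      φ (φ ⟦ E ⟧) * φ (φ ⟦ F ⟧)                 ≈⟨ *-congˡ (eval-quotientTerm F) ⟩
      φ (φ ⟦ E ⟧) * (⟦ F ⟧ + s * b)             ≈⟨ distribˡ _ _ _ ⟩
      φ (φ ⟦ E ⟧) * ⟦ F ⟧ + φ (φ ⟦ E ⟧) * (s * b)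
        ≈⟨ +-cong (*-congʳ (eval-quotientTerm E)) (*-congʳ (eval-frobeniusTerm E)) ⟩
      (⟦ E ⟧ + s * a) * ⟦ F ⟧ + g * (s * b)
        ≈⟨ solve 6 (λ e f s a b g → (e :+ s :* a) :* f :+ g :* (s :* b) := e :* f :+ s :* (a :* f :+ g :* b)) refl
             ⟦ E ⟧ ⟦ F ⟧ s a b g ⟩
      ⟦ E ⊠ F ⟧ + s * ⟦ quotientTerm (E ⊠ F) ⟧      ∎
      where
      a = ⟦ quotientTerm E ⟧
      b = ⟦ quotientTerm F ⟧
      g = ⟦ frobeniusTerm E ⟧

  -- `σ′` and `ξ′` encode the conjugation *: coefficients pass through φ and ξ goes to its inverse.
  -- `M` names -1 inside terms.
  module Descent {c} {C : Set c} (O I M : C) (σ σ′ : C → Carrier) (ξ ξ′ : Carrier)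
    (σO : σ O ≈ 0#) (σI : σ I ≈ 1#) (σM : σ M ≈ ε) (φφσ : ∀ x → φ (φ (σ x)) ≈ σ x)
    (σ′≈φσ : ∀ x → σ′ x ≈ φ (σ x)) (ξξ′≈1 : ξ * ξ′ ≈ 1#)
    (n′ k l m : ℕ) (qq≡ : q ℕ.* q ≡ suc (n′ ℕ.* k)) (q+1≡ : suc q ≡ n′ ℕ.* l) (q≡ : q ≡ suc (suc m))
    where

    private
      module S  = Evaluation B σ ξ
      module S′ = Evaluation B σ′ ξ′

    σ′O : σ′ O ≈ 0#
    σ′O = trans (σ′≈φσ O) (φ-0 σO)

    σ′I : σ′ I ≈ 1#
    σ′I = trans (σ′≈φσ I) (trans (φ-cong σI) (1^n≈1 q))

    σ′M : σ′ M ≈ ε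
    σ′M = trans (σ′≈φσ M) (trans (φ-cong σM) (ε^q≈ε p×1≈0 j))

    φφσ′ : ∀ x → φ (φ (σ′ x)) ≈ σ′ x
    φφσ′ x = trans (φφ-cong (σ′≈φσ x)) (trans (φ-cong (φφσ x)) (sym (σ′≈φσ x)))

    open Constructions O I q n′ k
    module Red  = Reduction O I σ ξ σO σI φφσ n′ k qq≡
    module Red′ = Reduction O I σ′ ξ′ σ′O σ′I φφσ′ n′ k qq≡
    open Red using (s)
    open Red′ using () renaming (s to s′)
    open import Relation.Binary.Reasoning.Setoid setoid

    -- Both sides are compatible with sums and products, so generators suffice. Constants agree by
    -- assumption, and ξ^q = ξ′ ξ^(q+1), where ξ^(q+1) = (ξ^n′)^l is 1 modulo s.
    conjugate≈frobenius : ∀ E → ∃[ w ] S′.⟦ E ⟧ + s * w ≈ φ S.⟦ E ⟧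
    conjugate≈frobenius (con x) = 0# , trans (+-congˡ (zeroʳ s)) (trans (+-identityʳ _) (σ′≈φσ x))
    conjugate≈frobenius var     = ξ′ * g , (begin
      ξ′ + s * (ξ′ * g)
        ≈⟨ +-cong (sym (*-identityʳ ξ′)) (solve 3 (λ a b c → b :* (a :* c) := a :* (b :* c)) refl ξ′ s g) ⟩
      ξ′ * 1# + ξ′ * (s * g)  ≈⟨ distribˡ ξ′ 1# _ ⟨
      ξ′ * (1# + s * g)       ≈⟨ *-congˡ (geometric-sum (ξ ^ n′) l) ⟨
      ξ′ * (ξ ^ n′) ^ l       ≈⟨ *-congˡ (^-assocʳ ξ n′ l) ⟩
      ξ′ * ξ ^ (n′ ℕ.* l)     ≈⟨ *-congˡ (^-congʳ ξ q+1≡) ⟨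
      ξ′ * (ξ * ξ ^ q)        ≈⟨ solve 3 (λ a b c → a :* (b :* c) := b :* a :* c) refl ξ′ ξ (ξ ^ q) ⟩
      ξ * ξ′ * ξ ^ q          ≈⟨ *-congʳ ξξ′≈1 ⟩
      1# * ξ ^ q              ≈⟨ *-identityˡ _ ⟩
      φ ξ                     ∎)
      where g = geometric (ξ ^ n′) l
    conjugate≈frobenius (E ⊞ F) with conjugate≈frobenius E | conjugate≈frobenius F
    ... | v , eq | w , eq′ = v + w , (begin
      S′.⟦ E ⟧ + S′.⟦ F ⟧ + s * (v + w)
        ≈⟨ solve 5 (λ e f s a b → (e :+ f) :+ s :* (a :+ b) := (e :+ s :* a) :+ (f :+ s :* b)) refl S′.⟦ E ⟧ S′.⟦ F ⟧ s v w ⟩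
      (S′.⟦ E ⟧ + s * v) + (S′.⟦ F ⟧ + s * w)   ≈⟨ +-cong eq eq′ ⟩
      φ S.⟦ E ⟧ + φ S.⟦ F ⟧                     ≈⟨ φ-+ _ _ ⟨
      φ (S.⟦ E ⟧ + S.⟦ F ⟧)                     ∎)
    conjugate≈frobenius (E ⊠ F) with conjugate≈frobenius E | conjugate≈frobenius F
    ... | v , eq | w , eq′ = v * (S′.⟦ F ⟧ + s * w) + S′.⟦ E ⟧ * w , (begin
      S′.⟦ E ⟧ * S′.⟦ F ⟧ + s * (v * (S′.⟦ F ⟧ + s * w) + S′.⟦ E ⟧ * w)
        ≈⟨ solve 5 (λ e f s a b → e :* f :+ s :* (a :* (f :+ s :* b) :+ e :* b) := (e :+ s :* a) :* (f :+ s :* b)) refl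
             S′.⟦ E ⟧ S′.⟦ F ⟧ s v w ⟩
      (S′.⟦ E ⟧ + s * v) * (S′.⟦ F ⟧ + s * w)   ≈⟨ *-cong eq eq′ ⟩
      φ S.⟦ E ⟧ * φ S.⟦ F ⟧                     ≈⟨ φ-* _ _ ⟨
      φ (S.⟦ E ⟧ * S.⟦ F ⟧)                     ∎)

    -- The identity x - 1 = -x (1/x - 1): s and its conjugate are associates, so s^i s′^i counts as
    -- s^(2i).
    s≈s′ : s ≈ ε * ξ ^ n′ * s′
    s≈s′ = sym (begin
      ε * x * (x′ + ε)           ≈⟨ solve 3 (λ e x y → e :* x :* (y :+ e) := e :* (x :* y) :+ (e :* e) :* x) refl ε x x′ ⟩
      ε * (x * x′) + ε * ε * x   ≈⟨ +-cong (*-congˡ (inv-^ ξξ′≈1 n′)) (*-congʳ ε*ε≈1) ⟩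
      ε * 1# + 1# * x            ≈⟨ +-cong (*-identityʳ ε) (*-identityˡ x) ⟩
      ε + x                      ≈⟨ +-comm ε x ⟩
      x + ε                      ∎)
      where
      x = ξ ^ n′
      x′ = ξ′ ^ n′

    module _ {P-1 : ℕ} (P≤qq : suc P-1 ℕ.≤ q ℕ.* q) (s^P≈0 : s ^ suc P-1 ≈ 0#)
      (cancel : ∀ E → s ^ P-1 * φ (φ S.⟦ E ⟧) ≈ 0# → φ (φ S.⟦ E ⟧) ≈ 0#)
      {D : Term C} (DD′≈0 : S.⟦ D ⟧ * S′.⟦ D ⟧ ≈ 0#) where

      -- Both factorisations are carried along, because an equation under the first evaluation is
      -- not assumed to transfer to the second.
      module Step (i : ℕ) (2i<P : i ℕ.+ i ℕ.≤ P-1) (E : Term C)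
        (D≈ : S.⟦ D ⟧ ≈ s ^ i * S.⟦ E ⟧) (D′≈ : S′.⟦ D ⟧ ≈ s′ ^ i * S′.⟦ E ⟧) where
        e = S.⟦ E ⟧
        e′ = S′.⟦ E ⟧
        v = ε * ξ ^ n′

        s^2i*ee′≈0 : s ^ (i ℕ.+ i) * (e * e′) ≈ 0#
        s^2i*ee′≈0 = begin
          s ^ (i ℕ.+ i) * (e * e′)          ≈⟨ *-congʳ (^-homo-* s i i) ⟩
          s ^ i * s ^ i * (e * e′)          ≈⟨ *-congʳ (*-congˡ (trans (^-congˡ i s≈s′) (^-distrib-* v s′ i))) ⟩
          s ^ i * (v ^ i * s′ ^ i) * (e * e′)
           
             ≈⟨ solve 5 (λ a b c d e → a :* (b :* c) :* (d :* e) := b :* ((a :* d) :* (c :* e))) refl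
                  (s ^ i) (v ^ i) (s′ ^ i) e e′ ⟩
          v ^ i * ((s ^ i * e) * (s′ ^ i * e′))   ≈⟨ *-congˡ (*-cong D≈ D′≈) ⟨
          v ^ i * (S.⟦ D ⟧ * S′.⟦ D ⟧)       ≈⟨ *-zeroʳ _ DD′≈0 ⟩
          0#                                ∎

        t : ℕ
        t = P-1 ∸ (i ℕ.+ i)

        t+2i≡ : t ℕ.+ (i ℕ.+ i) ≡ P-1
        t+2i≡ = ℕ.m∸n+n≡m 2i<P

        w = proj₁ (conjugate≈frobenius E)
        w-eq = proj₂ (conjugate≈frobenius E)

        -- Replacing φ(e) by the conjugate e′ costs a multiple of s, which s^(P-1) annihilates; the
        -- rest is a multiple of s^(2i) e e′ since 2i is at most P - 1.
        s^P-1*eφe≈0 : s ^ P-1 * (e * φ e) ≈ 0#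
        s^P-1*eφe≈0 = begin
          s ^ P-1 * (e * φ e)             ≈⟨ *-congˡ (*-congˡ w-eq) ⟨
          s ^ P-1 * (e * (e′ + s * w))
           
             ≈⟨ solve 5 (λ u e f s w → u :* (e :* (f :+ s :* w)) := u :* (e :* f) :+ (s :* u) :* (e :* w)) refl
                  (s ^ P-1) e e′ s w ⟩
          s ^ P-1 * (e * e′) + s ^ suc P-1 * (e * w)
            ≈⟨ +-zero lem (*-zeroˡ _ s^P≈0) ⟩
          0#                              ∎
          where
          lem : s ^ P-1 * (e * e′) ≈ 0#
          lem = begin
            s ^ P-1 * (e * e′)                  ≈⟨ *-congʳ (^-congʳ s t+2i≡) ⟨
            s ^ (t ℕ.+ (i ℕ.+ i)) * (e * e′)    ≈⟨ *-congʳ (^-homo-* s t (i ℕ.+ i)) ⟩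
            s ^ t * s ^ (i ℕ.+ i) * (e * e′)    ≈⟨ *-assoc _ _ _ ⟩
            s ^ t * (s ^ (i ℕ.+ i) * (e * e′))  ≈⟨ *-zeroʳ _ s^2i*ee′≈0 ⟩
            0#                                  ∎

        φφe≈0 : φ (φ e) ≈ 0#
        φφe≈0 = cancel E (zero-φφ m _ e q≡ s^P-1*eφe≈0)

        s^qq≈0 : s ^ (q ℕ.* q) ≈ 0#
        s^qq≈0 = begin
          s ^ (q ℕ.* q)              ≈⟨ ^-congʳ s (ℕ.m∸n+n≡m P≤qq) ⟨
          s ^ (u ℕ.+ suc P-1)        ≈⟨ ^-homo-* s u (suc P-1) ⟩
          s ^ u * s ^ suc P-1        ≈⟨ *-zeroʳ _ s^P≈0 ⟩
          0#                         ∎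
          where u = q ℕ.* q ∸ suc P-1

        -- Apply φ² to e′ + s w = φ(e). The right side vanishes with φ²(e), and φ²(s w) contains
        -- s^(q²), which is zero because P is at most q².
        φφe′≈0 : φ (φ e′) ≈ 0#
        φφe′≈0 = +-zeroʳ⁻ (begin
            φ (φ (s * w))           ≈⟨ φφ-* s w ⟩
            φ (φ s) * φ (φ w)       ≈⟨ *-zeroˡ _ (trans (^-assocʳ s q q) s^qq≈0) ⟩
            0#                      ∎)
          (begin
            φ (φ e′) + φ (φ (s * w))  ≈⟨ φφ-+ _ _ ⟨
            φ (φ (e′ + s * w))        ≈⟨ φφ-cong w-eq ⟩
            φ (φ (φ e))               ≈⟨ φ-0 φφe≈0 ⟩
            0#                        ∎)
          where
          +-zeroʳ⁻ : ∀ {x y} → y ≈ 0# → x + y ≈ 0# → x ≈ 0#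
          +-zeroʳ⁻ y≈0 eq = +-zeroˡ⁻ y≈0 (trans (+-comm _ _) eq)

        -- From 0 = E^(q²) = E + s · `quotientTerm E` it follows that E is s times this term, under
        -- either evaluation.
        E₁ : Term C
        E₁ = con M ⊠ quotientTerm E

        absorb : ∀ {σM s d e e₁} → σM ≈ ε → φ (φ e) ≈ 0# → φ (φ e) ≈ e + s * e₁ → d ≈ s ^ i * e →
                 d ≈ s ^ suc i * (σM * e₁)
        absorb {σM} {s} {d} {e} {e₁} σM≈ε φφe≈0 φφe≈ d≈ = begin
          d                                ≈⟨ d≈ ⟩
          s ^ i * e                        ≈⟨ *-congˡ (trans (x≈y+d⇒y≈x+εd (trans (sym φφe≈0) φφe≈)) (+-identityˡ _)) ⟩
          s ^ i * (ε * (s * e₁))           ≈⟨ *-congˡ (*-congʳ σM≈ε) ⟨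
          s ^ i * (σM * (s * e₁))
            ≈⟨ solve 4 (λ u e s x → u :* (e :* (s :* x)) := (s :* u) :* (e :* x)) refl
                 (s ^ i) σM s e₁ ⟩
          s ^ suc i * (σM * e₁)            ∎

        D≈₁ : S.⟦ D ⟧ ≈ s ^ suc i * S.⟦ E₁ ⟧
        D≈₁ = absorb σM φφe≈0 (Red.eval-quotientTerm E) D≈

        D′≈₁ : S′.⟦ D ⟧ ≈ s′ ^ suc i * S′.⟦ E₁ ⟧
        D′≈₁ = absorb σ′M φφe′≈0 (Red′.eval-quotientTerm E) D′≈

      descent : ∀ i → i ℕ.+ i ℕ.≤ suc P-1 →
        ∃[ E ] (S.⟦ D ⟧ ≈ s ^ i * S.⟦ E ⟧) ∧ (S′.⟦ D ⟧ ≈ s′ ^ i * S′.⟦ E ⟧)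
      descent zero    _ = D , sym (*-identityˡ _) , sym (*-identityˡ _)
      descent (suc i) (s≤s i+1+i≤P-1)
        with descent i (ℕ.m≤n⇒m≤1+n i+i≤P-1)
        where i+i≤P-1 = ℕ.≤-trans (ℕ.+-monoʳ-≤ i (ℕ.n≤1+n i)) i+1+i≤P-1
      ... | E , D≈ , D′≈ = Step.E₁ i 2i E D≈ D′≈ , Step.D≈₁ i 2i E D≈ D′≈ , Step.D′≈₁ i 2i E D≈ D′≈
        where 2i = ℕ.≤-trans (ℕ.+-monoʳ-≤ i (ℕ.n≤1+n i)) i+1+i≤P-1

-- The group ring as an algebra of shift operators

-- Polynomials in the shift operator, identified when they agree on the sequence δ.
module SequenceRing {c ℓ} (Q : CommutativeRing c ℓ) (δ : ℕ → CommutativeRing.Carrier Q) where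
  open CommutativeRing Q
  open RingLemmas Q

  Seq : Set c
  Seq = ℕ → Carrier

  infix 4 _≐_
  _≐_ : Seq → Seq → Set ℓ
  f ≐ g = ∀ k → f k ≈ g k

  act : Term Carrier → Seq → Seq
  act (con x) f k = x * f k
  act var     f k = f (suc k)
  act (E ⊞ F) f k = act E f k + act F f k
  act (E ⊠ F) f   = act E (act F f)

  act-cong : ∀ E {f g} → f ≐ g → act E f ≐ act E g
  act-cong (con x) eq k = *-congˡ (eq k)
  act-cong var     eq k = eq (suc k)
  act-cong (E ⊞ F) eq k = +-cong (act-cong E eq k) (act-cong F eq k)
  act-cong (E ⊠ F) eq   = act-cong E (act-cong F eq)

  act-shift : ∀ E f k → act E (λ i → f (suc i)) k ≈ act E f (suc k)
  act-shift (con x) f k = refl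
  act-shift var     f k = refl
  act-shift (E ⊞ F) f k = +-cong (act-shift E f k) (act-shift F f k)
  act-shift (E ⊠ F) f k = trans (act-cong E (act-shift F f) k) (act-shift E (act F f) k)

  act-scale : ∀ E x f k → act E (λ i → x * f i) k ≈ x * act E f k
  act-scale (con y) x f k = solve 3 (λ x y z → y :* (x :* z) := x :* (y :* z)) refl x y (f k)
  act-scale var     x f k = refl
  act-scale (E ⊞ F) x f k = trans (+-cong (act-scale E x f k) (act-scale F x f k)) (sym (distribˡ x _ _))
  act-scale (E ⊠ F) x f k = trans (act-cong E (act-scale F x f) k) (act-scale E x (act F f) k)

  act-add : ∀ E f g k → act E (λ i → f i + g i) k ≈ act E f k + act E g k
  act-add (con x) f g k = distribˡ x _ _
  act-add var     f g k = refl
  act-add (E ⊞ F) f g k = trans (+-cong (act-add E f g k) (act-add F f g k))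
    (solve 4 (λ a b c d → (a :+ b) :+ (c :+ d) := (a :+ c) :+ (b :+ d)) refl _ _ _ _)
  act-add (E ⊠ F) f g k = trans (act-cong E (act-add F f g) k) (act-add E _ _ k)

  -- Operators are built from scalars and the shift, and each of these commutes with every operator.
  act-comm : ∀ E F f → act E (act F f) ≐ act F (act E f)
  act-comm (con x) F f k = sym (act-scale F x f k)
  act-comm var     F f k = sym (act-shift F f k)
  act-comm (E ⊞ G) F f k = trans (+-cong (act-comm E F f k) (act-comm G F f k)) (sym (act-add F _ _ k))
  act-comm (E ⊠ G) F f k = trans (act-cong E (act-comm G F f) k) (act-comm E F (act G f) k)

  infix 4 _≋_
  record _≋_ (E F : Term Carrier) : Set ℓ where
    constructor mk
    field at : act E δ ≐ act F δ
  open _≋_ public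

  sequenceRing : CommutativeRing c ℓ
  sequenceRing = record
    { Carrier = Term Carrier
    ; _≈_ = _≋_
    ; _+_ = _⊞_
    ; _*_ = _⊠_
    ; -_  = con ε ⊠_
    ; 0#  = con 0#
    ; 1#  = con 1#
    ; isCommutativeRing = record
      { isRing = record
        { +-isAbelianGroup = record
          { isGroup = record
            { isMonoid = record
              { isSemigroup = record
                { isMagma = record
                  { isEquivalence = record
                    { refl = mk λ k → refl
                    ; sym = λ e → mk λ k → sym (at e k)
                    ; trans = λ e e′ → mk λ k → trans (at e k) (at e′ k)
                    }
                  ; ∙-cong = λ e e′ → mk λ k → +-cong (at e k) (at e′ k)
                  }
                ; assoc = λ E F G → mk λ k → +-assoc _ _ _
                }
              ; identity = (λ E → mk λ k → trans (+-congʳ (zeroˡ _)) (+-identityˡ _))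
                         , (λ E → mk λ k → trans (+-congˡ (zeroˡ _)) (+-identityʳ _))
              }
            ; inverse = (λ E → mk λ k → trans (+-comm _ _) (trans (x+εx≈0 _) (sym (zeroˡ _))))
                      , (λ E → mk λ k → trans (x+εx≈0 _) (sym (zeroˡ _)))
            ; ⁻¹-cong = λ e → mk λ k → *-congˡ (at e k)
            }
          ; comm = λ E F → mk λ k → +-comm _ _
          }
        -- Equality is tested on δ alone, so E may be replaced only where it meets δ directly; F is
        -- moved outside first and then back.
        ; *-cong = λ {E} {E′} {F} {F′} e e′ → mk λ k →
            trans (act-comm E F δ k) (trans (act-cong F (at e) k) (trans (act-comm F E′ δ k) (act-cong E′ (at e′) k)))
        ; *-assoc = λ E F G → mk λ k → refl
        ; *-identity = (λ E → mk λ k → *-identityˡ _)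
                     , (λ E → mk λ k → act-cong E (λ i → *-identityˡ _) k)
        ; distrib = (λ E F G → mk λ k → act-add E _ _ k) , (λ E F G → mk λ k → refl)
        }
      ; *-comm = λ E F → mk λ k → act-comm E F δ k
      }
    }

  private
    module A where
      open CommutativeRing sequenceRing public
      open RingLemmas sequenceRing public

  act-× : ∀ m E f k → act (m A.× E) f k ≈ m × act E f k
  act-× zero    E f k = zeroˡ _
  act-× (suc m) E f k = +-congˡ (act-× m E f k)

  act-var^ : ∀ m f k → act (var A.^ m) f k ≈ f (m ℕ.+ k)
  act-var^ zero    f k = *-identityˡ _
  act-var^ (suc m) f k = trans (act-var^ m f (suc k)) (reflexive (≡.cong f (ℕ.+-suc m k)))

  act-ε : ∀ f k → act A.ε f k ≈ ε * f k
  act-ε f k = *-congˡ (*-identityˡ _)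

  con-^ : ∀ x m → con x A.^ m A.≈ con (x ^ m)
  con-^ x zero    = A.refl
  con-^ x (suc m) = mk λ k → trans (*-congˡ (at (con-^ x m) k)) (sym (*-assoc x _ _))

  -- Only the constant term of the operator (X^N - 1)^m survives at k.
  act-differences : ∀ N m f k → (∀ i → 0 ℕ.< i → i ℕ.≤ m → f (i ℕ.* N ℕ.+ k) ≈ 0#) →
    act ((var A.^ N A.+ A.ε) A.^ m) f k ≈ ε ^ m * f k
  act-differences N zero    f k f≈0 = refl
  act-differences N (suc m) f k f≈0 = begin
    act s (act (s A.^ m) f) k           ≈⟨ act-comm s (s A.^ m) f k ⟩
    act (s A.^ m) (act s f) k           ≈⟨ act-differences N m (act s f) k vanish ⟩
    ε ^ m * act s f k                   ≈⟨ *-congˡ (act-s k) ⟩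
    ε ^ m * (f (N ℕ.+ k) + ε * f k)     ≈⟨ *-congˡ (+-congʳ (trans (reflexive (≡.cong (λ z → f (z ℕ.+ k)) (≡.sym (ℕ.*-identityˡ N)))) (f≈0 1 (s≤s z≤n) (s≤s z≤n)))) ⟩
    ε ^ m * (0# + ε * f k)              ≈⟨ *-congˡ (+-identityˡ _) ⟩
    ε ^ m * (ε * f k)                   ≈⟨ solve 3 (λ a b c → a :* (b :* c) := (b :* a) :* c) refl (ε ^ m) ε (f k) ⟩
    ε ^ suc m * f k                     ∎
    where
    open import Relation.Binary.Reasoning.Setoid setoid
    s = var A.^ N A.+ A.ε
    act-s : ∀ i → act s f i ≈ f (N ℕ.+ i) + ε * f i
    act-s i = +-cong (act-var^ N f i) (act-ε f i)
    vanish : ∀ i → 0 ℕ.< i → i ℕ.≤ m → act s f (i ℕ.* N ℕ.+ k) ≈ 0#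
    vanish i 0<i i≤m = trans (act-s _) (+-zero
      (trans (reflexive (≡.cong f (≡.sym (ℕ.+-assoc N (i ℕ.* N) k)))) (f≈0 (suc i) (s≤s z≤n) (s≤s i≤m)))
      (*-zeroʳ ε (f≈0 i 0<i (ℕ.m≤n⇒m≤1+n i≤m))))

-- Finite differences

prime∤⇒coprime : ∀ {p n} → Prime p → ¬ p ∣ n → Coprime p n
prime∤⇒coprime pp p∤n (d∣p , d∣n) with prime⇒irreducible pp d∣p
... | inj₁ d≡1 = d≡1
... | inj₂ ≡.refl = ⊥-elim (p∤n d∣n)

module Differences {r ℓ} (Q : CommutativeRing r ℓ) (N : ℕ) where
  open CommutativeRing Q
  open RingLemmas Q
  open import Relation.Binary.Reasoning.Setoid setoid

  Seq : Set r
  Seq = ℕ → Carrier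

  infix 4 _≐_
  _≐_ : Seq → Seq → Set ℓ
  f ≐ g = ∀ k → f k ≈ g k

  infixl 7 _·_
  _·_ : Seq → Seq → Seq
  (f · g) k = f k * g k

  infixl 6 _∔_
  _∔_ : Seq → Seq → Seq
  (f ∔ g) k = f k + g k

  𝟘 : Seq
  𝟘 _ = 0#

  Δ : Seq → Seq
  Δ f k = f (N ℕ.+ k) + ε * f k

  Δ^ : ℕ → Seq → Seq
  Δ^ zero    f = f
  Δ^ (suc m) f = Δ^ m (Δ f)

  Δ-cong : ∀ {f g} → f ≐ g → Δ f ≐ Δ g
  Δ-cong eq k = +-cong (eq _) (*-congˡ (eq k))

  Δ^-cong : ∀ m {f g} → f ≐ g → Δ^ m f ≐ Δ^ m g
  Δ^-cong zero    eq = eq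
  Δ^-cong (suc m) eq = Δ^-cong m (Δ-cong eq)

  Δ-∔ : ∀ f g → Δ (f ∔ g) ≐ Δ f ∔ Δ g
  Δ-∔ f g k = solve 5 (λ e a b c d → (a :+ b) :+ e :* (c :+ d) := (a :+ e :* c) :+ (b :+ e :* d)) refl
    ε (f (N ℕ.+ k)) (g (N ℕ.+ k)) (f k) (g k)

  Δ^-∔ : ∀ m f g → Δ^ m (f ∔ g) ≐ Δ^ m f ∔ Δ^ m g
  Δ^-∔ zero    f g k = refl
  Δ^-∔ (suc m) f g k = trans (Δ^-cong m (Δ-∔ f g) k) (Δ^-∔ m (Δ f) (Δ g) k)

  Δ-Δ^ : ∀ m f → Δ (Δ^ m f) ≐ Δ^ (suc m) f
  Δ-Δ^ zero    f k = refl
  Δ-Δ^ (suc m) f k = Δ-Δ^ m (Δ f) k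

  Δ-invariant : ∀ {f} → (∀ k → f (N ℕ.+ k) ≈ f k) → Δ f ≐ 𝟘
  Δ-invariant inv k = trans (+-congʳ (inv k)) (x+εx≈0 _)

  Δ≐𝟘⇒invariant : ∀ {f} → Δ f ≐ 𝟘 → ∀ k → f (N ℕ.+ k) ≈ f k
  Δ≐𝟘⇒invariant Δf≐𝟘 k = x+εy≈0⇒x≈y (Δf≐𝟘 k)

  Δ^-𝟘 : ∀ m → Δ^ m 𝟘 ≐ 𝟘
  Δ^-𝟘 zero    k = refl
  Δ^-𝟘 (suc m) k = trans (Δ^-cong m (Δ-invariant (λ _ → refl)) k) (Δ^-𝟘 m k)

  Δ-·-constˡ : ∀ f g → Δ f ≐ 𝟘 → Δ (f · g) ≐ f · Δ g
  Δ-·-constˡ f g Δf≐𝟘 k = begin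
    f (N ℕ.+ k) * g (N ℕ.+ k) + ε * (f k * g k)   ≈⟨ +-congʳ (*-congʳ (Δ≐𝟘⇒invariant Δf≐𝟘 k)) ⟩
    f k * g (N ℕ.+ k) + ε * (f k * g k)
      ≈⟨ solve 4 (λ e x y z → x :* y :+ e :* (x :* z) := x :* (y :+ e :* z)) refl ε (f k) _ _ ⟩
    f k * (g (N ℕ.+ k) + ε * g k)                 ∎

  Δ^-·-constˡ : ∀ m f g → Δ f ≐ 𝟘 → Δ^ m (f · g) ≐ f · Δ^ m g
  Δ^-·-constˡ zero    f g Δf≐𝟘 k = refl
  Δ^-·-constˡ (suc m) f g Δf≐𝟘 k =
    trans (Δ^-cong m (Δ-·-constˡ f g Δf≐𝟘) k) (Δ^-·-constˡ m f (Δ g) Δf≐𝟘 k)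

  -- Δ is a shift minus 1 and the shift is multiplicative; this produces the third term, which a
  -- derivation would not have.
  Δ-· : ∀ f g → Δ (f · g) ≐ Δ f · g ∔ f · Δ g ∔ Δ f · Δ g
  Δ-· f g k = sym (begin
    (F + ε * x) * y + x * (G + ε * y) + (F + ε * x) * (G + ε * y)
      ≈⟨ solve 5 (λ e F x G y →
           (F :+ e :* x) :* y :+ x :* (G :+ e :* y) :+ (F :+ e :* x) :* (G :+ e :* y)
           := (F :* G :+ e :* (x :* y)) :+ (F :* y :+ e :* (F :* y)) :+ (x :* G :+ e :* (x :* G))
              :+ (x :* y :+ e :* (x :* y)) :* e) refl ε F x G y ⟩
    (F * G + ε * (x * y)) + (F * y + ε * (F * y)) + (x * G + ε * (x * G)) + (x * y + ε * (x * y)) * ε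
      ≈⟨ +-cong (+-cong (+-congˡ (x+εx≈0 _)) (x+εx≈0 _)) (*-zeroˡ ε (x+εx≈0 _)) ⟩
    F * G + ε * (x * y) + 0# + 0# + 0#  ≈⟨ trans (+-identityʳ _) (trans (+-identityʳ _) (+-identityʳ _)) ⟩
    F * G + ε * (x * y)                 ∎)
    where
    F = f (N ℕ.+ k)
    x = f k
    G = g (N ℕ.+ k)
    y = g k

  Δ-× : ∀ m f → Δ f ≐ 𝟘 → Δ (λ k → m × f k) ≐ 𝟘
  Δ-× m f Δf≐𝟘 = Δ-invariant (λ k → ×-congʳ m (Δ≐𝟘⇒invariant Δf≐𝟘 k))

  -- The leading coefficient of a product of polynomials of degrees at most a and b, in difference
  -- form. The two mixed terms of `Δ-·` add up by Pascal's rule; the third, Δ f · Δ g, has degree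
  -- two below the product and is killed by the remaining differences.
  leibniz : ∀ a b f g → Δ^ (suc a) f ≐ 𝟘 → Δ^ (suc b) g ≐ 𝟘 →
    ∀ k → Δ^ (a ℕ.+ b) (f · g) k ≈ ((a ℕ.+ b) C a) × (Δ^ a f k * Δ^ b g k)
  leibniz zero b f g f0 g0 k = begin
    Δ^ b (f · g) k            ≈⟨ Δ^-·-constˡ b f g f0 k ⟩
    f k * Δ^ b g k            ≈⟨ ×-homo-1 _ ⟨
    1 × (f k * Δ^ b g k)      ≈⟨ ×-congˡ (≡.sym (≡.trans (nCk≡nC[n∸k] {0} {b} z≤n) (nCn≡1 b))) ⟩
    (b C 0) × (f k * Δ^ b g k)  ∎
  leibniz (suc a) zero f g f0 g0 k rewrite ℕ.+-identityʳ a = begin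
    Δ^ (suc a) (f · g) k         ≈⟨ Δ^-cong (suc a) (λ i → *-comm (f i) (g i)) k ⟩
    Δ^ (suc a) (g · f) k         ≈⟨ Δ^-·-constˡ (suc a) g f g0 k ⟩
    g k * Δ^ (suc a) f k         ≈⟨ *-comm _ _ ⟩
    Δ^ (suc a) f k * g k         ≈⟨ ×-homo-1 _ ⟨
    1 × (Δ^ (suc a) f k * g k)   ≈⟨ ×-congˡ (≡.sym (nCn≡1 (suc a))) ⟩
    (suc a C suc a) × (Δ^ (suc a) f k * g k)   ∎
  leibniz (suc a) (suc b) f g f0 g0 k = begin
    Δ^ m (Δ (f · g)) k                                       ≈⟨ Δ^-cong m (Δ-· f g) k ⟩
    Δ^ m (Δ f · g ∔ f · Δ g ∔ Δ f · Δ g) k                   ≈⟨ Δ^-∔ m _ _ k ⟩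
    Δ^ m (Δ f · g ∔ f · Δ g) k + Δ^ m (Δ f · Δ g) k          ≈⟨ +-cong (Δ^-∔ m _ _ k) third ⟩
    Δ^ m (Δ f · g) k + Δ^ m (f · Δ g) k + 0#                 ≈⟨ +-identityʳ _ ⟩
    Δ^ m (Δ f · g) k + Δ^ m (f · Δ g) k                      ≈⟨ +-cong (leibniz a (suc b) (Δ f) g f0 g0 k) second ⟩
    (m C a) × top k + (m C suc a) × top k                    ≈⟨ ×-homo-+ (top k) (m C a) (m C suc a) ⟨
    ((m C a) ℕ.+ (m C suc a)) × top k                        ≈⟨ ×-congˡ (nCk+nC[k+1]≡[n+1]C[k+1] m a) ⟩
    (suc m C suc a) × top k                                  ∎
    where
    m = a ℕ.+ suc b
    top = Δ^ (suc a) f · Δ^ (suc b) g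
    second : Δ^ m (f · Δ g) k ≈ (m C suc a) × top k
    second = ≡.subst (λ z → Δ^ z (f · Δ g) k ≈ (z C suc a) × top k) (≡.sym (ℕ.+-suc a b))
      (leibniz (suc a) b f (Δ g) f0 g0 k)
    Δtop≐𝟘 : Δ top ≐ 𝟘
    Δtop≐𝟘 i = trans (Δ-·-constˡ (Δ^ (suc a) f) (Δ^ (suc b) g) (λ l → trans (Δ-Δ^ (suc a) f l) (f0 l)) i)
      (*-zeroʳ _ (trans (Δ-Δ^ (suc b) g i) (g0 i)))
    third : Δ^ m (Δ f · Δ g) k ≈ 0#
    third = begin
      Δ^ m (Δ f · Δ g) k                ≈⟨ reflexive (≡.cong (λ z → Δ^ z (Δ f · Δ g) k) (ℕ.+-suc a b)) ⟩
      Δ^ (suc (a ℕ.+ b)) (Δ f · Δ g) k  ≈⟨ Δ-Δ^ (a ℕ.+ b) _ k ⟨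
      Δ (Δ^ (a ℕ.+ b) (Δ f · Δ g)) k    ≈⟨ Δ-cong (leibniz a b (Δ f) (Δ g) f0 g0) k ⟩
      Δ (λ i → ((a ℕ.+ b) C a) × top i) k  ≈⟨ Δ-× ((a ℕ.+ b) C a) top Δtop≐𝟘 k ⟩
      0#                                ∎

  module _ {p : ℕ} (p-prime : Prime p) (j : ℕ) (p×1≈0 : p × 1# ≈ 0#) where
    open CharP Q p-prime j p×1≈0
    open Frobenius Q p-prime

    Δ^-φ : ∀ m f → Δ^ m (λ k → φ (f k)) ≐ (λ k → φ (Δ^ m f k))
    Δ^-φ zero    f k = refl
    Δ^-φ (suc m) f k = trans (Δ^-cong m Δ-φ k) (Δ^-φ m (Δ f) k)
      where
      Δ-φ : Δ (λ i → φ (f i)) ≐ (λ i → φ (Δ f i))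
      Δ-φ i = sym (trans (φ-+ _ _) (+-congˡ (trans (φ-* _ _) (*-congʳ (ε^q≈ε p×1≈0 j)))))

    module _ (φφ≈id : ∀ x → φ (φ x) ≈ x) {m : ℕ} (q≡ : q ≡ suc (suc m))
      (a : Seq) (a·φa≈1 : ∀ k → a k * φ (a k) ≈ 1#) where

      -- The coefficient C(2D,D) can be cancelled because 2D < p keeps p out of it, while p
      -- annihilates everything. Then y φ(y) = 0 gives y = 0 through φ² = 1.
      lower-degree : ∀ d → suc d ℕ.+ suc d ℕ.< p → Δ^ (suc (suc d)) a ≐ 𝟘 → Δ^ (suc d) a ≐ 𝟘
      lower-degree d 2d<p a0 k = begin
        y            ≈⟨ φφ≈id y ⟨
        φ (φ y)      ≈⟨ *-identityˡ _ ⟨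
        1# * φ (φ y) ≈⟨ zero-φφ m 1# y q≡ (trans (*-identityˡ _) yφy≈0) ⟩
        0#           ∎
        where
        D = suc d
        y = Δ^ D a k
        φa : Seq
        φa i = φ (a i)
        C×yφy≈0 : ((D ℕ.+ D) C D) × (y * φ y) ≈ 0#
        C×yφy≈0 = begin
          ((D ℕ.+ D) C D) × (y * φ y)         ≈⟨ ×-congʳ ((D ℕ.+ D) C D) (*-congˡ (Δ^-φ D a k)) ⟨
          ((D ℕ.+ D) C D) × (y * Δ^ D φa k)
            ≈⟨ leibniz D D a φa a0 (λ i → trans (Δ^-φ (suc D) a i) (φ-0 (a0 i))) k ⟨
          -- D + D is suc (d + D): the first difference already kills the constant sequence 1.
          Δ^ (D ℕ.+ D) (a · φa) k             ≈⟨ Δ^-cong (d ℕ.+ D) (Δ-invariant λ i → trans (a·φa≈1 _) (sym (a·φa≈1 i))) k ⟩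
          Δ^ (d ℕ.+ D) 𝟘 k                    ≈⟨ Δ^-𝟘 (d ℕ.+ D) k ⟩
          0#                                  ∎
        yφy≈0 : y * φ y ≈ 0#
        yφy≈0 = coprime-×-zero _
          (prime∤⇒coprime p-prime (prime∤C p-prime (D ℕ.+ D) D (ℕ.m≤m+n D D) 2d<p)) (p×x≈0 p×1≈0 _) C×yφy≈0

      small-degree⇒invariant : ∀ d → d ℕ.+ d ℕ.< p → Δ^ (suc d) a ≐ 𝟘 → Δ a ≐ 𝟘
      small-degree⇒invariant zero    2d<p a0 = a0
      small-degree⇒invariant (suc d) 2d<p a0 = small-degree⇒invariant d
        (ℕ.≤-<-trans (ℕ.+-mono-≤ (ℕ.n≤1+n d) (ℕ.n≤1+n d)) 2d<p) (lower-degree d 2d<p a0)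

-- Invariance of the first row modulo p

⌊n/2⌋+⌊n/2⌋≤n : ∀ n → ⌊ n /2⌋ ℕ.+ ⌊ n /2⌋ ℕ.≤ n
⌊n/2⌋+⌊n/2⌋≤n n = ℕ.≤-trans (ℕ.+-monoʳ-≤ ⌊ n /2⌋ (ℕ.⌊n/2⌋≤⌈n/2⌉ n)) (ℕ.≤-reflexive (ℕ.⌊n/2⌋+⌈n/2⌉≡n n))

-- The two halves of the argument meet here: the descent makes the ⌈p/2⌉-th difference vanish, so
-- the degree is at most d = ⌊(p-1)/2⌋, just inside the range 2d < p. For p = 2 this d is 0.
⌈n/2⌉≡1+d : ∀ n → 1 ℕ.< n → ∃[ d ] ⌈ n /2⌉ ≡ suc d ∧ d ℕ.+ d ℕ.< n
⌈n/2⌉≡1+d (suc (suc n)) _ = ⌊ suc n /2⌋ , ≡.refl , s≤s (⌊n/2⌋+⌊n/2⌋≤n (suc n))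
⌈n/2⌉≡1+d (suc zero) (s≤s ())

-- Finite sums and the periodic unit sequence

module SumBelow {r ℓ} (Q : CommutativeRing r ℓ) where
  open CommutativeRing Q
  open RingLemmas Q

  sumBelow : ℕ → (ℕ → Carrier) → Carrier
  sumBelow zero    f = 0#
  sumBelow (suc m) f = f 0 + sumBelow m (λ i → f (suc i))

  sumBelow-cong : ∀ m {f g} → (∀ i → i ℕ.< m → f i ≈ g i) → sumBelow m f ≈ sumBelow m g
  sumBelow-cong zero    eq = refl
  sumBelow-cong (suc m) eq = +-cong (eq 0 (s≤s z≤n)) (sumBelow-cong m λ i i<m → eq (suc i) (s≤s i<m))

  sumBelow-zero : ∀ m {f} → (∀ i → i ℕ.< m → f i ≈ 0#) → sumBelow m f ≈ 0#
  sumBelow-zero zero    eq = refl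
  sumBelow-zero (suc m) eq = +-zero (eq 0 (s≤s z≤n)) (sumBelow-zero m λ i i<m → eq (suc i) (s≤s i<m))

  sumBelow-single : ∀ m {f} t → t ℕ.< m → (∀ i → i ℕ.< m → i ≢ t → f i ≈ 0#) → sumBelow m f ≈ f t
  sumBelow-single (suc m) zero    t<m eq =
    trans (+-congˡ (sumBelow-zero m λ i i<m → eq (suc i) (s≤s i<m) λ ())) (+-identityʳ _)
  sumBelow-single (suc m) (suc t) (s≤s t<m) eq = trans
    (+-cong (eq 0 (s≤s z≤n) λ ()) (sumBelow-single m t t<m λ i i<m i≢t → eq (suc i) (s≤s i<m) λ e → i≢t (ℕ.suc-injective e)))
    (+-identityˡ _)

module Delta {r ℓ} (Q : CommutativeRing r ℓ) (n : ℕ) where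
  open CommutativeRing Q

  -- The unit of the group ring of the cyclic group of order n, unrolled to a periodic sequence; its
  -- periodicity is what makes X^n = 1.
  δ : ℕ → Carrier
  δ k = if does (n ∣? k) then 1# else 0#

  δ-∣ : ∀ {k} → n ∣ k → δ k ≈ 1#
  δ-∣ {k} n∣k with n ∣? k
  ... | yes _ = refl
  ... | no n∤k = ⊥-elim (n∤k n∣k)

  δ-∤ : ∀ {k} → ¬ n ∣ k → δ k ≈ 0#
  δ-∤ {k} n∤k with n ∣? k
  ... | yes n∣k = ⊥-elim (n∤k n∣k)
  ... | no _ = refl

  δ-periodic : ∀ k → δ (n ℕ.+ k) ≈ δ k
  δ-periodic k with n ∣? k
  ... | yes n∣k = δ-∣ (∣m∣n⇒∣m+n ∣-refl n∣k)
  ... | no n∤k = δ-∤ (λ n∣n+k → n∤k (∣m+n∣m⇒∣n n∣n+k ∣-refl))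

n∣n∸g+k⇒g≡k%n : ∀ n g k .{{_ : NonZero n}} → g ℕ.< n → n ∣ n ∸ g ℕ.+ k → g ≡ k % n
n∣n∸g+k⇒g≡k%n n g k g<n n∣ = ≡.sym (begin
  k % n                              ≡⟨ [m+n]%n≡m%n k n ⟨
  (k ℕ.+ n) % n                      ≡⟨ ≡.cong (_% n) eq ⟩
  (g ℕ.+ quotient n∣ ℕ.* n) % n      ≡⟨ [m+kn]%n≡m%n g (quotient n∣) n ⟩
  g % n                              ≡⟨ m<n⇒m%n≡m g<n ⟩
  g                                  ∎)
  where
  open ≡.≡-Reasoning
  eq : k ℕ.+ n ≡ g ℕ.+ quotient n∣ ℕ.* n
  eq = begin
    k ℕ.+ n                          ≡⟨ ≡.cong (k ℕ.+_) (ℕ.m+[n∸m]≡n (ℕ.<⇒≤ g<n)) ⟨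
    k ℕ.+ (g ℕ.+ (n ∸ g))            ≡⟨ lem k g (n ∸ g) ⟩
    g ℕ.+ (n ∸ g ℕ.+ k)              ≡⟨ ≡.cong (g ℕ.+_) (_∣_.equality n∣) ⟩
    g ℕ.+ quotient n∣ ℕ.* n          ∎
    where
    lem : ∀ a b c → a ℕ.+ (b ℕ.+ c) ≡ b ℕ.+ (c ℕ.+ a)
    lem = solve-∀

n∣n∸[k%n]+k : ∀ n k .{{_ : NonZero n}} → n ∣ n ∸ k % n ℕ.+ k
n∣n∸[k%n]+k n k = divides (suc (k / n)) (begin
  n ∸ k % n ℕ.+ k                            ≡⟨ ≡.cong (n ∸ k % n ℕ.+_) (m≡m%n+[m/n]*n k n) ⟩
  n ∸ k % n ℕ.+ (k % n ℕ.+ k / n ℕ.* n)      ≡⟨ ℕ.+-assoc (n ∸ k % n) (k % n) _ ⟨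
  n ∸ k % n ℕ.+ k % n ℕ.+ k / n ℕ.* n        ≡⟨ ≡.cong (ℕ._+ k / n ℕ.* n) (ℕ.m∸n+n≡m (ℕ.<⇒≤ (m%n<n k n))) ⟩
  n ℕ.+ k / n ℕ.* n                          ∎)
  where
  open ≡.≡-Reasoning

-- Modulo n this is (-g)(-1) = g: conjugating X^(n-g), that is, substituting X^(n-1) for X, yields
-- X^g.
[n∸g]*[n∸1]≡g+u*n : ∀ n g → g ℕ.< n → (n ∸ g) ℕ.* (n ∸ 1) ≡ (n ∸ suc g) ℕ.* n ℕ.+ g
[n∸g]*[n∸1]≡g+u*n n g g<n = ≡.subst (λ m → (m ∸ g) ℕ.* (m ∸ 1) ≡ (m ∸ suc g) ℕ.* m ℕ.+ g)
  (ℕ.m+[n∸m]≡n g<n) (aux (n ∸ suc g))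
  where
  aux : ∀ u → (suc g ℕ.+ u ∸ g) ℕ.* (g ℕ.+ u) ≡ (suc g ℕ.+ u ∸ suc g) ℕ.* (suc g ℕ.+ u) ℕ.+ g
  aux u rewrite ℕ.m+n∸m≡n g u | ≡.sym (ℕ.+-suc g u) | ℕ.m+n∸m≡n g (suc u) | ℕ.+-suc g u = lem g u
    where
    lem : ∀ g u → suc u ℕ.* (g ℕ.+ u) ≡ u ℕ.* suc (g ℕ.+ u) ℕ.+ g
    lem = solve-∀

-- The first row as an element of the group ring

module Invariance {r ℓ} (Q : CommutativeRing r ℓ) {p : ℕ} (p-prime : Prime p) (j : ℕ)
  (p×1≈0 : RingLemmas.HasCharacteristic Q p)
  (b n′ k l m : ℕ) .{{_ : NonZero n′}}
  (qq≡ : (p ℕ.^ j) ℕ.* (p ℕ.^ j) ≡ suc (n′ ℕ.* k))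
  (q+1≡ : suc (p ℕ.^ j) ≡ n′ ℕ.* l) (q≡ : p ℕ.^ j ≡ suc (suc m))
  (P∣q : p ℕ.^ suc b ∣ p ℕ.^ j) (coprime : Coprime (p ℕ.^ suc b) n′) where
  open CommutativeRing Q
  open RingLemmas Q
  open SumBelow Q
  open import Relation.Binary.Reasoning.Setoid setoid
  open CharP Q p-prime j p×1≈0

  P N n : ℕ
  P = p ℕ.^ suc b
  N = n′ ℕ.* p ℕ.^ b
  n = n′ ℕ.* P

  instance
    p≢0 : NonZero p
    p≢0 = prime⇒nonZero p-prime
    P≢0 : NonZero P
    P≢0 = ℕ.m^n≢0 p (suc b)
    n≢0 : NonZero n
    n≢0 = ℕ.m*n≢0 n′ P

  open Delta Q n
  open SequenceRing Q δ
  private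
    module A where
      open CommutativeRing sequenceRing public
      open RingLemmas sequenceRing public

  p×1≈0A : p A.× A.1# A.≈ A.0#
  p×1≈0A = mk λ i → begin
    act (p A.× con 1#) δ i   ≈⟨ act-× p (con 1#) δ i ⟩
    p × (1# * δ i)           ≈⟨ Frobenius.p×x≈0 Q p-prime p×1≈0 _ ⟩
    0#                       ≈⟨ zeroˡ _ ⟨
    0# * δ i                 ∎

  module Φ = CharP sequenceRing p-prime j p×1≈0A

  module _ (φφ≈id : ∀ x → φ (φ x) ≈ x) (a : ℕ → Carrier) (a-periodic : ∀ i → a (n ℕ.+ i) ≈ a i)
    (a·φa≈1 : ∀ i → a i * φ (a i) ≈ 1#)
    (correlation : ∀ i → sumBelow n (λ g → φ (a g) * a (g ℕ.+ i)) ≈ 0#) where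

    a-periodic* : ∀ u i → a (u ℕ.* n ℕ.+ i) ≈ a i
    a-periodic* zero    i = refl
    a-periodic* (suc u) i = trans (reflexive (≡.cong a (ℕ.+-assoc n (u ℕ.* n) i))) (trans (a-periodic _) (a-periodic* u i))

    ξ′ : Term Carrier
    ξ′ = var A.^ (n ∸ 1)

    σ′ : Carrier → Term Carrier
    σ′ x = con (φ x)

    con-φ : ∀ x → Φ.φ (con x) A.≈ con (φ x)
    con-φ x = con-^ x q

    ξξ′≈1 : var A.* ξ′ A.≈ A.1#
    ξξ′≈1 = mk λ i → begin
      act (var A.^ suc (n ∸ 1)) δ i   ≈⟨ act-var^ (suc (n ∸ 1)) δ i ⟩
      δ (suc (n ∸ 1) ℕ.+ i)           ≈⟨ reflexive (≡.cong (λ z → δ (z ℕ.+ i)) (ℕ.suc-pred n)) ⟩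
      δ (n ℕ.+ i)                     ≈⟨ δ-periodic i ⟩
      δ i                             ≈⟨ *-identityˡ _ ⟨
      1# * δ i                        ∎

    open module Desc = Φ.Descent {C = Carrier} 0# 1# ε con σ′ var ξ′
      A.refl A.refl (mk λ i → sym (act-ε δ i))
      (λ x → A.trans (Φ.φ-cong (con-φ x)) (A.trans (con-φ (φ x)) (mk λ i → *-congʳ (φφ≈id x))))
      (λ x → A.sym (con-φ x)) ξξ′≈1 n′ k l m qq≡ q+1≡ q≡
      using (module Red; module Red′; descent)
    open Red using (s)
    open Constructions 0# 1# q n′ k
    module S  = Evaluation sequenceRing con var
    module S′ = Evaluation sequenceRing σ′ ξ′

    act-varPower : ∀ u f i → act S.⟦ varPower u ⟧ f i ≈ f (u ℕ.+ i)
    act-varPower zero    f i = *-identityˡ _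
    act-varPower (suc u) f i = trans (act-varPower u f (suc i)) (reflexive (≡.cong f (ℕ.+-suc u i)))

    act-varPower′ : ∀ u f i → act S′.⟦ varPower u ⟧ f i ≈ f (u ℕ.* (n ∸ 1) ℕ.+ i)
    act-varPower′ zero    f i = trans (*-congʳ (1^n≈1 q)) (*-identityˡ _)
    act-varPower′ (suc u) f i = begin
      act ξ′ (act S′.⟦ varPower u ⟧ f) i              ≈⟨ act-var^ (n ∸ 1) _ i ⟩
      act S′.⟦ varPower u ⟧ f (n ∸ 1 ℕ.+ i)           ≈⟨ act-varPower′ u f _ ⟩
      f (u ℕ.* (n ∸ 1) ℕ.+ (n ∸ 1 ℕ.+ i))             ≈⟨ reflexive (≡.cong f (lem u (n ∸ 1) i)) ⟩
      f (suc u ℕ.* (n ∸ 1) ℕ.+ i)                     ∎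
      where
      lem : ∀ u v i → u ℕ.* v ℕ.+ (v ℕ.+ i) ≡ suc u ℕ.* v ℕ.+ i
      lem = solve-∀

    termSum : ℕ → (ℕ → Term Carrier) → Term Carrier
    termSum zero    F = con 0#
    termSum (suc u) F = F 0 ⊞ termSum u (λ i → F (suc i))

    act-termSum : ∀ u F f i → act S.⟦ termSum u F ⟧ f i ≈ sumBelow u (λ g → act S.⟦ F g ⟧ f i)
    act-termSum zero    F f i = zeroˡ _
    act-termSum (suc u) F f i = +-congˡ (act-termSum u _ f i)

    act-termSum′ : ∀ u F f i → act S′.⟦ termSum u F ⟧ f i ≈ sumBelow u (λ g → act S′.⟦ F g ⟧ f i)
    act-termSum′ zero    F f i = *-zeroˡ _ (φ-0 refl)
    act-termSum′ (suc u) F f i = +-congˡ (act-termSum′ u _ f i)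

    -- `var` shifts forward, so the coefficient of X^(-k) is found at position k; the exponent n - g
    -- thus puts a g at position g.
    D : Term Carrier
    D = termSum n (λ g → con (a g) ⊠ varPower (n ∸ g))

    act-D : ∀ i → act S.⟦ D ⟧ δ i ≈ a i
    act-D i = begin
      act S.⟦ D ⟧ δ i                                    ≈⟨ act-termSum n _ δ i ⟩
      sumBelow n (λ g → a g * act S.⟦ varPower (n ∸ g) ⟧ δ i)
        ≈⟨ sumBelow-cong n (λ g _ → *-congˡ (act-varPower (n ∸ g) δ i)) ⟩
      sumBelow n (λ g → a g * δ (n ∸ g ℕ.+ i))
        ≈⟨ sumBelow-single n (i % n) (m%n<n i n) (λ g g<n g≢ → *-zeroʳ _ (δ-∤ λ n∣ → g≢ (n∣n∸g+k⇒g≡k%n n g i g<n n∣))) ⟩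
      a (i % n) * δ (n ∸ i % n ℕ.+ i)                    ≈⟨ *-congˡ (δ-∣ (n∣n∸[k%n]+k n i)) ⟩
      a (i % n) * 1#                                     ≈⟨ *-identityʳ _ ⟩
      a (i % n)                                          ≈⟨ a-periodic* (i / n) (i % n) ⟨
      a (i / n ℕ.* n ℕ.+ i % n)
        ≈⟨ reflexive (≡.cong a (≡.sym (≡.trans (m≡m%n+[m/n]*n i n) (ℕ.+-comm (i % n) _)))) ⟩
      a i                                                ∎

    -- Since D sends δ to a, the product amounts to D* acting on the sequence a, and that yields the
    -- periodic autocorrelation of a.
    DD′≈0 : S.⟦ D ⟧ A.* S′.⟦ D ⟧ A.≈ A.0#
    DD′≈0 = mk λ i → begin
      act S.⟦ D ⟧ (act S′.⟦ D ⟧ δ) i             ≈⟨ act-comm S.⟦ D ⟧ S′.⟦ D ⟧ δ i ⟩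
      act S′.⟦ D ⟧ (act S.⟦ D ⟧ δ) i             ≈⟨ act-cong S′.⟦ D ⟧ act-D i ⟩
      act S′.⟦ D ⟧ a i                           ≈⟨ act-termSum′ n _ a i ⟩
      sumBelow n (λ g → φ (a g) * act S′.⟦ varPower (n ∸ g) ⟧ a i)
        ≈⟨ sumBelow-cong n (λ g g<n → *-congˡ (shift i g g<n)) ⟩
      sumBelow n (λ g → φ (a g) * a (g ℕ.+ i))   ≈⟨ correlation i ⟩
      0#                                         ≈⟨ zeroˡ _ ⟨
      0# * δ i                                   ∎
      where
      shift : ∀ i g → g ℕ.< n → act S′.⟦ varPower (n ∸ g) ⟧ a i ≈ a (g ℕ.+ i)
      shift i g g<n = begin
        act S′.⟦ varPower (n ∸ g) ⟧ a i              ≈⟨ act-varPower′ (n ∸ g) a i ⟩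
        a ((n ∸ g) ℕ.* (n ∸ 1) ℕ.+ i)                ≈⟨ reflexive (≡.cong (λ z → a (z ℕ.+ i)) ([n∸g]*[n∸1]≡g+u*n n g g<n)) ⟩
        a ((n ∸ suc g) ℕ.* n ℕ.+ g ℕ.+ i)            ≈⟨ reflexive (≡.cong a (ℕ.+-assoc _ g i)) ⟩
        a ((n ∸ suc g) ℕ.* n ℕ.+ (g ℕ.+ i))          ≈⟨ a-periodic* (n ∸ suc g) _ ⟩
        a (g ℕ.+ i)                                  ∎

    -- Used twice: e = b + 1 gives s^P = X^n - 1 = 0, and e = b identifies the difference operator
    -- of step n/p with s^(P/p).
    s-frobenius : ∀ e → s A.^ (p ℕ.^ e) A.≈ var A.^ (n′ ℕ.* p ℕ.^ e) A.+ A.ε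
    s-frobenius e = A.trans (Frobenius.frobenius-+ sequenceRing p-prime p×1≈0A e _ _)
      (A.+-cong (A.^-assocʳ var n′ (p ℕ.^ e)) (Frobenius.ε^q≈ε sequenceRing p-prime p×1≈0A e))

    s^P≈0 : s A.^ P A.≈ A.0#
    s^P≈0 = A.trans (s-frobenius (suc b)) (A.trans (A.+-congʳ X^n≈1) A.1+ε≈0)
      where
      X^n≈1 : var A.^ n A.≈ A.1#
      X^n≈1 = mk λ i → trans (act-var^ n δ i) (trans (δ-periodic i) (sym (*-identityˡ _)))

    Supported : (ℕ → Carrier) → Set ℓ
    Supported f = ∀ i → ¬ P ∣ i → f i ≈ 0#

    -- Only `var` moves entries, and here it has become a shift by q², a multiple of P.
    supported-frobeniusTerm : ∀ E {f} → Supported f → Supported (act S.⟦ frobeniusTerm E ⟧ f)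
    supported-frobeniusTerm (con x) f0 i P∤i = *-zeroʳ x (f0 i P∤i)
    supported-frobeniusTerm var     f0 i P∤i = trans (act-varPower (q ℕ.* q) _ i)
      (f0 _ λ P∣ → P∤i (∣m+n∣m⇒∣n P∣ (∣m⇒∣m*n q P∣q)))
    supported-frobeniusTerm (E ⊞ F) f0 i P∤i =
      +-zero (supported-frobeniusTerm E f0 i P∤i) (supported-frobeniusTerm F f0 i P∤i)
    supported-frobeniusTerm (E ⊠ F) f0 = supported-frobeniusTerm E (supported-frobeniusTerm F f0)

    -- E^(q²) lives on multiples of P. If P divides i, then by coprimality P does not divide i + u
    -- n′ for 0 < u < P, so expanding (X^n′ - 1)^(P-1) at i leaves only the constant term, a sign
    -- times the entry at i.
    cancel : ∀ E → s A.^ (P ∸ 1) A.* Φ.φ (Φ.φ S.⟦ E ⟧) A.≈ A.0# → Φ.φ (Φ.φ S.⟦ E ⟧) A.≈ A.0#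
    cancel E eq = A.trans (Red.eval-frobeniusTerm E) (mk λ i → trans (g≈0 i) (sym (zeroˡ _)))
      where
      g : ℕ → Carrier
      g = act S.⟦ frobeniusTerm E ⟧ δ
      g-supported : Supported g
      g-supported = supported-frobeniusTerm E (λ i P∤i → δ-∤ λ n∣i → P∤i (∣-trans (divides n′ ≡.refl) n∣i))
      off : ∀ i → P ∣ i → ∀ u → 0 ℕ.< u → u ℕ.≤ P ∸ 1 → g (u ℕ.* n′ ℕ.+ i) ≈ 0#
      off i P∣i u 0<u u≤P-1 = g-supported _ λ P∣ → ℕ.<⇒≱
        (ℕ.≤-<-trans u≤P-1 (ℕ.≤-reflexive (ℕ.suc-pred P)))
        (∣⇒≤ {{ℕ.>-nonZero 0<u}} (coprime-divisor coprime
          (≡.subst (P ∣_) (ℕ.*-comm u n′) (∣m+n∣m⇒∣n (≡.subst (P ∣_) (ℕ.+-comm (u ℕ.* n′) i) P∣) P∣i))))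
      on : ∀ i → P ∣ i → g i ≈ 0#
      on i P∣i = begin
        g i                            ≈⟨ *-identityˡ _ ⟨
        1# * g i                       ≈⟨ *-congʳ (inv-^ ε*ε≈1 (P ∸ 1)) ⟨
        ε ^ (P ∸ 1) * ε ^ (P ∸ 1) * g i  ≈⟨ *-assoc _ _ _ ⟩
        ε ^ (P ∸ 1) * (ε ^ (P ∸ 1) * g i)
          ≈⟨ *-congˡ (act-differences n′ (P ∸ 1) g i (off i P∣i)) ⟨
        ε ^ (P ∸ 1) * act (s A.^ (P ∸ 1)) g i   ≈⟨ *-zeroʳ _ s^P-1g≈0 ⟩
        0#                             ∎
        where
        s^P-1g≈0 : act (s A.^ (P ∸ 1)) g i ≈ 0#
        s^P-1g≈0 = trans (act-cong (s A.^ (P ∸ 1)) (λ u → sym (at (Red.eval-frobeniusTerm E) u)) i)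
          (trans (at eq i) (zeroˡ _))
      g≈0 : ∀ i → g i ≈ 0#
      g≈0 i with P ∣? i
      ... | yes P∣i = on i P∣i
      ... | no P∤i = g-supported i P∤i

    open Differences Q N using (Δ; Δ^; Δ-Δ^; small-degree⇒invariant; Δ≐𝟘⇒invariant)

    T : Term Carrier
    T = var A.^ N A.+ A.ε

    act-T^ : ∀ u f i → act (T A.^ u) f i ≈ Δ^ u f i
    act-T^ zero    f i = *-identityˡ _
    act-T^ (suc u) f i = begin
      act T (act (T A.^ u) f) i        ≈⟨ act-cong T (act-T^ u f) i ⟩
      act T (Δ^ u f) i                 ≈⟨ +-cong (act-var^ N (Δ^ u f) i) (act-ε (Δ^ u f) i) ⟩
      Δ (Δ^ u f) i                     ≈⟨ Δ-Δ^ u f i ⟩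
      Δ^ (suc u) f i                   ∎

    -- The exponent is the largest multiple of p^b whose double is at most P. Being such a multiple,
    -- it is complemented to P by ⌈p/2⌉ copies of p^b, that is, by a power of `T`.
    s^⌊P/2⌋∣D : ∃[ E ] S.⟦ D ⟧ A.≈ s A.^ (⌊ p /2⌋ ℕ.* p ℕ.^ b) A.* S.⟦ E ⟧
    s^⌊P/2⌋∣D = proj₁ factor , proj₁ (proj₂ factor)
      where
      i = ⌊ p /2⌋ ℕ.* p ℕ.^ b
      1+[P-1]≡P : suc (P ∸ 1) ≡ P
      1+[P-1]≡P = ℕ.suc-pred P
      P≤qq : suc (P ∸ 1) ℕ.≤ q ℕ.* q
      P≤qq = ℕ.≤-trans (ℕ.≤-reflexive 1+[P-1]≡P)
        (∣⇒≤ {{ℕ.m*n≢0 q q {{ℕ.m^n≢0 p j}} {{ℕ.m^n≢0 p j}}}} (∣m⇒∣m*n q P∣q))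
      2i≤P : i ℕ.+ i ℕ.≤ suc (P ∸ 1)
      2i≤P = ℕ.≤-trans (ℕ.≤-reflexive (≡.sym (ℕ.*-distribʳ-+ (p ℕ.^ b) ⌊ p /2⌋ ⌊ p /2⌋)))
        (ℕ.≤-trans (ℕ.*-monoˡ-≤ (p ℕ.^ b) (⌊n/2⌋+⌊n/2⌋≤n p)) (ℕ.≤-reflexive (≡.sym 1+[P-1]≡P)))
      factor = descent P≤qq (A.trans (A.^-congʳ s 1+[P-1]≡P) s^P≈0) cancel {D} DD′≈0 i 2i≤P

    T^⌈p/2⌉*D≈0 : T A.^ ⌈ p /2⌉ A.* S.⟦ D ⟧ A.≈ A.0#
    T^⌈p/2⌉*D≈0 = ≈A.begin
      T A.^ c A.* S.⟦ D ⟧                                ≈A.≈⟨ A.*-congʳ (A.^-congˡ c (A.sym (s-frobenius b))) ⟩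
      (s A.^ P′) A.^ c A.* S.⟦ D ⟧                       ≈A.≈⟨ A.*-cong (A.^-assocʳ s P′ c) (proj₂ s^⌊P/2⌋∣D) ⟩
      s A.^ (P′ ℕ.* c) A.* (s A.^ (h ℕ.* P′) A.* e)      ≈A.≈⟨ A.*-assoc (s A.^ (P′ ℕ.* c)) (s A.^ (h ℕ.* P′)) e ⟨
      s A.^ (P′ ℕ.* c) A.* s A.^ (h ℕ.* P′) A.* e        ≈A.≈⟨ A.*-congʳ (A.^-homo-* s (P′ ℕ.* c) (h ℕ.* P′)) ⟨
      s A.^ (P′ ℕ.* c ℕ.+ h ℕ.* P′) A.* e                ≈A.≈⟨ A.*-congʳ (A.^-congʳ s exponent) ⟩
      s A.^ P A.* e                                      ≈A.≈⟨ A.*-zeroˡ e s^P≈0 ⟩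
      A.0#                                               ≈A.∎
      where
      import Relation.Binary.Reasoning.Setoid A.setoid as ≈A
      c = ⌈ p /2⌉
      h = ⌊ p /2⌋
      P′ = p ℕ.^ b
      e = S.⟦ proj₁ s^⌊P/2⌋∣D ⟧
      exponent : P′ ℕ.* c ℕ.+ h ℕ.* P′ ≡ P
      exponent = ≡.trans (lem P′ c h) (≡.cong (ℕ._* P′) (ℕ.⌊n/2⌋+⌈n/2⌉≡n p))
        where
        lem : ∀ x c h → x ℕ.* c ℕ.+ h ℕ.* x ≡ (h ℕ.+ c) ℕ.* x
        lem = solve-∀

    Δ^⌈p/2⌉a≐0 : ∀ i → Δ^ ⌈ p /2⌉ a i ≈ 0#
    Δ^⌈p/2⌉a≐0 i = begin
      Δ^ c a i                           ≈⟨ act-T^ c a i ⟨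
      act (T A.^ c) a i                  ≈⟨ act-cong (T A.^ c) (λ u → sym (act-D u)) i ⟩
      act (T A.^ c A.* S.⟦ D ⟧) δ i       ≈⟨ at T^⌈p/2⌉*D≈0 i ⟩
      0# * δ i                           ≈⟨ zeroˡ _ ⟩
      0#                                 ∎
      where c = ⌈ p /2⌉

    invariance : ∀ i → a (N ℕ.+ i) ≈ a i
    invariance with ⌈n/2⌉≡1+d p (ℕ.nonTrivial⇒n>1 p {{prime⇒nonTrivial p-prime}})
    ... | d , c≡ , 2d<p = Δ≐𝟘⇒invariant (small-degree⇒invariant p-prime j p×1≈0 φφ≈id q≡ a a·φa≈1 d 2d<p
         (≡.subst (λ z → ∀ i → Δ^ z a i ≈ 0#) c≡ Δ^⌈p/2⌉a≐0))

-- Finitely generated subrings and their quotients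

module GeneratedSubring {c ℓ} (R : CommutativeRing c ℓ) where
  open CommutativeRing R
  open RingLemmas R
  open import Relation.Binary.Reasoning.Setoid setoid

  data Generated (L : List Carrier) : Carrier → Set (c ⊔ ℓ) where
    gen  : ∀ {x} → x ∈ L → Generated L x
    one  : Generated L 1#
    add  : ∀ {x y} → Generated L x → Generated L y → Generated L (x + y)
    mul  : ∀ {x y} → Generated L x → Generated L y → Generated L (x * y)
    neg  : ∀ {x} → Generated L x → Generated L (- x)
    resp : ∀ {x y} → x ≈ y → Generated L x → Generated L y

  gen-zero : ∀ {L} → Generated L 0#
  gen-zero = resp 1+ε≈0 (add one (neg one))

  gen-× : ∀ {L} m → Generated L (m × 1#)
  gen-× zero    = gen-zero
  gen-× (suc m) = add one (gen-× m)

  module Spans (L : List Carrier) where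

    S : Carrier → Set (c ⊔ ℓ)
    S = Generated L

    data Span : List Carrier → Carrier → Set (c ⊔ ℓ) where
      nil  : ∀ {x} → x ≈ 0# → Span [] x
      cons : ∀ {t e es x y} → S t → Span es y → x ≈ t * e + y → Span (e ∷ es) x

    span-resp : ∀ {es x y} → x ≈ y → Span es x → Span es y
    span-resp eq (nil e)         = nil (trans (sym eq) e)
    span-resp eq (cons St sp e)  = cons St sp (trans (sym eq) e)

    span-zero : ∀ es → Span es 0#
    span-zero []       = nil refl
    span-zero (e ∷ es) = cons gen-zero (span-zero es) (sym (+-zero (zeroˡ e) refl))

    span-add : ∀ {es x y} → Span es x → Span es y → Span es (x + y)
    span-add (nil x≈0) (nil y≈0) = nil (+-zero x≈0 y≈0)
    span-add (cons {t} {e} {y = x′} St sp eq) (cons {t′} {y = y′} St′ sp′ eq′) = cons (add St St′) (span-add sp sp′)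
      (trans (+-cong eq eq′)
        (solve 5 (λ t t′ e x y → (t :* e :+ x) :+ (t′ :* e :+ y) := (t :+ t′) :* e :+ (x :+ y)) refl t t′ e x′ y′))

    span-scale : ∀ {es x t} → S t → Span es x → Span es (t * x)
    span-scale St (nil x≈0) = nil (*-zeroʳ _ x≈0)
    span-scale {t = t} St (cons {t′} {e} {y = y} St′ sp eq) = cons (mul St St′) (span-scale St sp)
      (trans (*-congˡ eq) (solve 4 (λ t t′ e y → t :* (t′ :* e :+ y) := t :* t′ :* e :+ t :* y) refl t t′ e y))

    span-there : ∀ {e es x} → Span es x → Span (e ∷ es) x
    span-there sp = cons gen-zero sp (sym (trans (+-congʳ (zeroˡ _)) (+-identityˡ _)))

    span-here : ∀ {e es} → Span (e ∷ es) e
    span-here {es = es} = cons one (span-zero es) (sym (trans (+-identityʳ _) (*-identityˡ _)))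

    module Nakayama {π : Carrier} (Sπ : S π) where

      Principal : Carrier → Set (c ⊔ ℓ)
      Principal u = ∃[ v ] S v ∧ u ≈ 1# + π * v

      principal-* : ∀ {u u′} → Principal u → Principal u′ → Principal (u * u′)
      principal-* {u} {u′} (v , Sv , eq) (v′ , Sv′ , eq′) = v * u′ + v′ ,
        add (mul Sv (resp (sym eq′) (add one (mul Sπ Sv′)))) Sv′ , (begin
          u * u′                           ≈⟨ *-congʳ eq ⟩
          (1# + π * v) * u′                ≈⟨ distribʳ u′ 1# _ ⟩
          1# * u′ + π * v * u′             ≈⟨ +-congʳ (trans (*-identityˡ u′) eq′) ⟩
          1# + π * v′ + π * v * u′
            ≈⟨ solve 5 (λ o p v u w → o :+ p :* w :+ p :* v :* u := o :+ p :* (v :* u :+ w)) refl 1# π v u′ v′ ⟩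
          1# + π * (v * u′ + v′)           ∎)

      principal-shift : ∀ {u t} → Principal u → S t → Principal (u + ε * (π * t))
      principal-shift {u} {t} (v , Sv , eq) St = v + ε * t , add Sv (mul (neg one) St) ,
        trans (+-congʳ eq)
          (solve 5 (λ o p v e t → o :+ p :* v :+ e :* (p :* t) := o :+ p :* (v :+ e :* t)) refl 1# π v ε t)

      principal-S : ∀ {u} → Principal u → S u
      principal-S (v , Sv , eq) = resp (sym eq) (add one (mul Sπ Sv))

      -- The determinant trick, done by division-free elimination: generators are removed one at a
      -- time, and every multiplier stays in the multiplicatively closed set 1 + πS.
      nakayama : ∀ es {u} → Principal u → All (λ e → ∃[ y ] Span es y ∧ u * e ≈ π * y) es →
        ∃[ v ] Principal v ∧ All (λ e → v * e ≈ 0#) es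
      nakayama [] Pu [] = _ , Pu , []
      nakayama (e ∷ es) {u} Pu ((y , cons {t} {y = y′} St sp y≈ , ue≈) ∷ eqs) =
        v′ * v , principal-* Pv′ Pv , killed-e ∷ All.map kill killed
        where
        -- Moves the diagonal part π t e of the relation for e to the left side, so that v e
        -- involves only the other generators.
        v = u + ε * (π * t)
        Pv : Principal v
        Pv = principal-shift Pu St
        ve≈ : v * e ≈ π * y′
        ve≈ = begin
          (u + ε * (π * t)) * e                              ≈⟨ distribʳ e u _ ⟩
          u * e + ε * (π * t) * e                            ≈⟨ +-congʳ (trans ue≈ (*-congˡ y≈)) ⟩
          π * (t * e + y′) + ε * (π * t) * e
            ≈⟨ solve 5 (λ p t e y ep → p :* (t :* e :+ y) :+ ep :* (p :* t) :* e
                 := p :* y :+ (p :* t :* e :+ ep :* (p :* t :* e))) refl π t e y′ ε ⟩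
          π * y′ + (π * t * e + ε * (π * t * e))             ≈⟨ +-congˡ (x+εx≈0 _) ⟩
          π * y′ + 0#                                        ≈⟨ +-identityʳ _ ⟩
          π * y′                                             ∎
        -- Multiplying by v trades the e-coordinate of z for π y′, leaving a relation among the
        -- remaining generators.
        eliminate : ∀ {f} → ∃[ z ] Span (e ∷ es) z ∧ u * f ≈ π * z → ∃[ z ] Span es z ∧ (v * u) * f ≈ π * z
        eliminate {f} (z , cons {t₁} {y = z′} St₁ sp₁ z≈ , uf≈) =
          t₁ * π * y′ + v * z′ , span-add (span-scale (mul St₁ Sπ) sp) (span-scale (principal-S Pv) sp₁) , (begin
            v * u * f                            ≈⟨ *-assoc v u f ⟩
            v * (u * f)                          ≈⟨ *-congˡ (trans uf≈ (*-congˡ z≈)) ⟩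
            v * (π * (t₁ * e + z′))
              ≈⟨ solve 5 (λ v p t e z → v :* (p :* (t :* e :+ z)) := p :* (t :* (v :* e) :+ v :* z)) refl v π t₁ e z′ ⟩
            π * (t₁ * (v * e) + v * z′)          ≈⟨ *-congˡ (+-congʳ (trans (*-congˡ ve≈) (sym (*-assoc t₁ π y′)))) ⟩
            π * (t₁ * π * y′ + v * z′)           ∎)
        rec = nakayama es (principal-* Pv Pu) (All.map eliminate eqs)
        v′ = proj₁ rec
        Pv′ = proj₁ (proj₂ rec)
        killed = proj₂ (proj₂ rec)
        kill : ∀ {f} → v′ * f ≈ 0# → v′ * v * f ≈ 0#
        kill {f} eq = trans (solve 3 (λ a b c → a :* b :* c := b :* (a :* c)) refl v′ v f) (*-zeroʳ v eq)
        kill-span : ∀ {es x} → All (λ f → v′ * f ≈ 0#) es → Span es x → v′ * x ≈ 0#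
        kill-span [] (nil x≈0) = *-zeroʳ v′ x≈0
        kill-span {x = x} (eq ∷ eqs) (cons {t} {f} {y = y} St sp x≈) = begin
          v′ * x                     ≈⟨ *-congˡ x≈ ⟩
          v′ * (t * f + y)           ≈⟨ solve 4 (λ v t f y → v :* (t :* f :+ y) := t :* (v :* f) :+ v :* y) refl v′ t f y ⟩
          t * (v′ * f) + v′ * y      ≈⟨ +-zero (*-zeroʳ t eq) (kill-span eqs sp) ⟩
          0#                         ∎
        killed-e : v′ * v * e ≈ 0#
        killed-e = begin
          v′ * v * e        ≈⟨ *-assoc v′ v e ⟩
          v′ * (v * e)      ≈⟨ *-congˡ ve≈ ⟩
          v′ * (π * y′)     ≈⟨ solve 3 (λ a b c → a :* (b :* c) := b :* (a :* c)) refl v′ π y′ ⟩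
          π * (v′ * y′)     ≈⟨ *-zeroʳ π (kill-span killed sp) ⟩
          0#                ∎

    module Powers (a : Carrier) (h-1 : ℕ) (a^h≈1 : a ^ suc h-1 ≈ 1#) where

      h : ℕ
      h = suc h-1

      powers : ℕ → List Carrier
      powers zero    = []
      powers (suc m) = a ^ m ∷ powers m

      span-power< : ∀ {m} i → i ℕ.< m → Span (powers m) (a ^ i)
      span-power< {suc m} i (s≤s i≤m) with ℕ.m≤n⇒m<n∨m≡n i≤m
      ... | inj₁ i<m    = span-there (span-power< i i<m)
      ... | inj₂ ≡.refl = span-here

      span-power : ∀ i → Span (powers h) (a ^ i)
      span-power i = span-resp (begin
        a ^ (i % h)                          ≈⟨ *-identityʳ _ ⟨
        a ^ (i % h) * 1#                     ≈⟨ *-congˡ (1^n≈1 (i / h)) ⟨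
        a ^ (i % h) * 1# ^ (i / h)           ≈⟨ *-congˡ (^-congˡ (i / h) a^h≈1) ⟨
        a ^ (i % h) * (a ^ h) ^ (i / h)      ≈⟨ *-congˡ (trans (^-swap a h (i / h)) (^-assocʳ a (i / h) h)) ⟩
        a ^ (i % h) * a ^ (i / h ℕ.* h)      ≈⟨ ^-homo-* a (i % h) _ ⟨
        a ^ (i % h ℕ.+ i / h ℕ.* h)          ≈⟨ ^-congʳ a (≡.sym (m≡m%n+[m/n]*n i h)) ⟩
        a ^ i                                ∎) (span-power< (i % h) (m%n<n i h))

      span-power* : ∀ m i {x} → Span (powers m) x → Span (powers h) (a ^ i * x)
      span-power* zero    i (nil x≈0) = span-resp (sym (*-zeroʳ _ x≈0)) (span-zero _)
      span-power* (suc m) i {x} (cons {t} {y = y} St sp x≈) = span-resp (sym (begin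
        a ^ i * x                          ≈⟨ *-congˡ x≈ ⟩
        a ^ i * (t * a ^ m + y)
          ≈⟨ solve 4 (λ u t v y → u :* (t :* v :+ y) := t :* (u :* v) :+ u :* y) refl
               (a ^ i) t (a ^ m) y ⟩
        t * (a ^ i * a ^ m) + a ^ i * y    ≈⟨ +-congʳ (*-congˡ (^-homo-* a i m)) ⟨
        t * a ^ (i ℕ.+ m) + a ^ i * y      ∎))
        (span-add (span-scale St (span-power (i ℕ.+ m))) (span-power* m i sp))

      span-mul : ∀ m {x y} → Span (powers m) x → Span (powers h) y → Span (powers h) (x * y)
      span-mul zero    (nil x≈0) spy = span-resp (sym (*-zeroˡ _ x≈0)) (span-zero _)
      span-mul (suc m) {x} {y} (cons {t} {y = x′} St sp x≈) spy = span-resp (sym (begin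
        x * y                       ≈⟨ *-congʳ x≈ ⟩
        (t * a ^ m + x′) * y
          ≈⟨ solve 4 (λ t u x y → (t :* u :+ x) :* y := t :* (u :* y) :+ x :* y) refl
               t (a ^ m) x′ y ⟩
        t * (a ^ m * y) + x′ * y    ∎))
        (span-add (span-scale St (span-power* h m spy)) (span-mul m sp spy))

      span-one : Span (powers h) 1#
      span-one = span-power 0

      span-S : ∀ {x} → S x → Span (powers h) x
      span-S Sx = span-resp (*-identityʳ _) (span-scale Sx span-one)

      generated⇒span : ∀ {x} → Generated (a ∷ L) x → Span (powers h) x
      generated⇒span (gen (here ≡.refl)) = span-resp (*-identityʳ a) (span-power 1)
      generated⇒span (gen (there x∈L))   = span-S (gen x∈L)
      generated⇒span one                 = span-one
      generated⇒span (add Gx Gy)         = span-add (generated⇒span Gx) (generated⇒span Gy)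
      generated⇒span (mul Gx Gy)         = span-mul h (generated⇒span Gx) (generated⇒span Gy)
      generated⇒span (neg Gx)            = span-resp (-1*x≈-x _) (span-scale (neg one) (generated⇒span Gx))
      generated⇒span (resp eq Gx)        = span-resp eq (generated⇒span Gx)

      all-powers : ∀ {Pr : Carrier → Set (c ⊔ ℓ)} → (∀ i → Pr (a ^ i)) → ∀ m → All Pr (powers m)
      all-powers pr zero    = []
      all-powers pr (suc m) = pr m ∷ all-powers pr m

      at-one : ∀ {Pr : Carrier → Set ℓ} m → All Pr (powers (suc m)) → Pr 1#
      at-one zero    (pr ∷ _)   = pr
      at-one (suc m) (_ ∷ prs) = at-one m prs

      -- If π is invertible in S[a], then each power of a lies in π times the span of finitely many
      -- powers, so some 1 + π v kills all those generators. Among them is a^0 = 1, hence 1 + π v =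
      -- 0 and π is invertible in S already.
      descend : ∀ {π} → S π → ∃[ w ] Generated (a ∷ L) w ∧ 1# ≈ π * w → ∃[ w ] S w ∧ 1# ≈ π * w
      descend {π} Sπ (w , Gw , 1≈πw) = ε * v , mul (neg one) Sv , (begin
        1#                ≈⟨ x≈y+d⇒y≈x+εd (trans (sym N*1≈0) (trans (*-identityʳ N) N≈)) ⟩
        0# + ε * (π * v)  ≈⟨ +-identityˡ _ ⟩
        ε * (π * v)       ≈⟨ solve 3 (λ a b c → a :* (b :* c) := b :* (a :* c)) refl ε π v ⟩
        π * (ε * v)       ∎)
        where
        open Nakayama Sπ
        multiples : ∀ i → ∃[ y ] Span (powers h) y ∧ 1# * a ^ i ≈ π * y
        multiples i = w * a ^ i , span-mul h (generated⇒span Gw) (span-power i) ,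
          trans (*-congʳ 1≈πw) (*-assoc π w _)
        -- The initial multiplier is 1, written as 1 + π 0.
        result = nakayama (powers h) (0# , gen-zero , sym (trans (+-congˡ (zeroʳ π)) (+-identityʳ 1#)))
          (all-powers multiples h)
        N = proj₁ result
        v = proj₁ (proj₁ (proj₂ result))
        Sv = proj₁ (proj₂ (proj₁ (proj₂ result)))
        N≈ : N ≈ 1# + π * v
        N≈ = proj₂ (proj₂ (proj₁ (proj₂ result)))
        N*1≈0 : N * 1# ≈ 0#
        N*1≈0 = at-one h-1 (proj₂ (proj₂ result))

  -- The subring generated by nothing is the image of ℤ; an integer is presented as the difference k
  -- - l of naturals.
  integer : ∀ {x} → Generated [] x → ∃[ k ] ∃[ l ] x + l × 1# ≈ k × 1#
  integer (gen ())
  integer one = 1 , 0 , refl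
  integer (add {x} {y} Gx Gy) with integer Gx | integer Gy
  ... | k , l , eq | k′ , l′ , eq′ = k ℕ.+ k′ , l ℕ.+ l′ , (begin
    x + y + (l ℕ.+ l′) × 1#               ≈⟨ +-congˡ (×-homo-+ 1# l l′) ⟩
    x + y + (l × 1# + l′ × 1#)            ≈⟨ solve 4 (λ x y l m → x :+ y :+ (l :+ m) := (x :+ l) :+ (y :+ m)) refl x y _ _ ⟩
    (x + l × 1#) + (y + l′ × 1#)          ≈⟨ +-cong eq eq′ ⟩
    k × 1# + k′ × 1#                      ≈⟨ ×-homo-+ 1# k k′ ⟨
    (k ℕ.+ k′) × 1#                       ∎)
  integer (mul {x} {y} Gx Gy) with integer Gx | integer Gy
  ... | k , l , eq | k′ , l′ , eq′ = k ℕ.* k′ ℕ.+ l ℕ.* l′ , k ℕ.* l′ ℕ.+ l ℕ.* k′ , (begin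
    x * y + (k ℕ.* l′ ℕ.+ l ℕ.* k′) × 1#              ≈⟨ +-congˡ (two k l′ l k′) ⟩
    x * y + (K * L′ + L * K′)                         ≈⟨ +-congˡ (+-cong (*-congʳ (sym eq)) (*-congˡ (sym eq′))) ⟩
    x * y + ((x + L) * L′ + L * (y + L′))
      ≈⟨ solve 4 (λ x y l m → x :* y :+ ((x :+ l) :* m :+ l :* (y :+ m)) := (x :+ l) :* (y :+ m) :+ l :* m) refl x y L L′ ⟩
    (x + L) * (y + L′) + L * L′                       ≈⟨ +-congʳ (*-cong eq eq′) ⟩
    K * K′ + L * L′                                   ≈⟨ two k k′ l l′ ⟨
    (k ℕ.* k′ ℕ.+ l ℕ.* l′) × 1#                      ∎)
    where
    K = k × 1#
    K′ = k′ × 1#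
    L = l × 1#
    L′ = l′ × 1#
    two : ∀ a b c d → (a ℕ.* b ℕ.+ c ℕ.* d) × 1# ≈ (a × 1#) * (b × 1#) + (c × 1#) * (d × 1#)
    two a b c d = trans (×-homo-+ 1# (a ℕ.* b) (c ℕ.* d)) (+-cong (×1-homo-* a b) (×1-homo-* c d))
  integer (neg {x} Gx) with integer Gx
  ... | k , l , eq = l , k , (begin
    - x + k × 1#              ≈⟨ +-congˡ eq ⟨
    - x + (x + l × 1#)        ≈⟨ +-assoc _ _ _ ⟨
    - x + x + l × 1#          ≈⟨ +-congʳ (-‿inverseˡ x) ⟩
    0# + l × 1#               ≈⟨ +-identityˡ _ ⟩
    l × 1#                    ∎)
  integer (resp eq Gx) with integer Gx
  ... | k , l , eq′ = k , l , trans (+-congʳ (sym eq)) eq′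

  module _ (char0 : ∀ k → k × 1# ≈ 0# → k ≡ 0) where

    ×1-injective-≤ : ∀ {k l} → k ℕ.≤ l → k × 1# ≈ l × 1# → k ≡ l
    ×1-injective-≤ {k} {l} k≤l eq = ℕ.≤-antisym k≤l (ℕ.m∸n≡0⇒m≤n (char0 (l ∸ k) (+-cancelˡ (k × 1#) _ _ (begin
      k × 1# + (l ∸ k) × 1#    ≈⟨ ×-homo-+ 1# k (l ∸ k) ⟨
      (k ℕ.+ (l ∸ k)) × 1#     ≈⟨ ×-congˡ (ℕ.m+[n∸m]≡n k≤l) ⟩
      l × 1#                   ≈⟨ eq ⟨
      k × 1#                   ≈⟨ +-identityʳ _ ⟨
      k × 1# + 0#              ∎))))

    ×1-injective : ∀ {k l} → k × 1# ≈ l × 1# → k ≡ l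
    ×1-injective {k} {l} eq with ℕ.≤-total k l
    ... | inj₁ k≤l = ×1-injective-≤ k≤l eq
    ... | inj₂ l≤k = ≡.sym (×1-injective-≤ l≤k (sym eq))

    -- Roots of unity are removed one at a time by `descend`, until p would be invertible in the
    -- image of ℤ; characteristic zero then yields p l + 1 = p k among the naturals.
    p-nonunit : ∀ {p} → 1 ℕ.< p → ∀ L h-1 → All (IsRootOfUnity (suc h-1)) L →
      ¬ (∃[ w ] Generated L w ∧ 1# ≈ (p × 1#) * w)
    p-nonunit {p} 1<p (a ∷ L) h-1 (a^h≈1 ∷ roots) w =
      p-nonunit 1<p L h-1 roots (Spans.Powers.descend L a h-1 a^h≈1 (gen-× p) w)
    p-nonunit {p} 1<p [] h-1 [] (w , Gw , eq) with integer Gw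
    ... | k , l , eq′ = ℕ.<⇒≱ 1<p (∣⇒≤ (∣m+n∣m⇒∣n {n = 1} p∣pl+1 (m∣m*n l)))
      where
      1+pl≡pk : p ℕ.* l ℕ.+ 1 ≡ p ℕ.* k
      1+pl≡pk = ×1-injective (begin
        (p ℕ.* l ℕ.+ 1) × 1#                     ≈⟨ ×-homo-+ 1# (p ℕ.* l) 1 ⟩
        (p ℕ.* l) × 1# + 1 × 1#                  ≈⟨ +-cong (×1-homo-* p l) (trans (×-homo-1 1#) eq) ⟩
        (p × 1#) * (l × 1#) + (p × 1#) * w       ≈⟨ distribˡ _ _ _ ⟨
        (p × 1#) * (l × 1# + w)                  ≈⟨ *-congˡ (trans (+-comm _ _) eq′) ⟩
        (p × 1#) * (k × 1#)                      ≈⟨ ×1-homo-* p k ⟨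
        (p ℕ.* k) × 1#                           ∎)
      p∣pl+1 : p ∣ p ℕ.* l ℕ.+ 1
      p∣pl+1 = ≡.subst (p ∣_) (≡.sym 1+pl≡pk) (m∣m*n k)

-- The quotient of a generated subring by a principal ideal

module QuotientRing {c ℓ} (R : CommutativeRing c ℓ)
  (L : List (CommutativeRing.Carrier R)) (π : CommutativeRing.Carrier R) where
  open CommutativeRing R
  open RingLemmas R
  open GeneratedSubring R
  open import Relation.Binary.Reasoning.Setoid setoid

  Elem : Set (c ⊔ ℓ)
  Elem = Σ Carrier (Generated L)

  infix 4 _∼_
  -- The witness has to lie in the subring: if π is invertible in R, arbitrary witnesses would make
  -- all elements congruent.
  record _∼_ (x y : Elem) : Set (c ⊔ ℓ) where
    constructor mk∼
    field
      {witness} : Carrier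
      inSubring : Generated L witness
      equation  : proj₁ x ≈ proj₁ y + π * witness

  ≈⇒∼ : ∀ {x y} → proj₁ x ≈ proj₁ y → x ∼ y
  ≈⇒∼ eq = mk∼ gen-zero (trans eq (sym (trans (+-congˡ (zeroʳ π)) (+-identityʳ _))))

  ∼-sym : ∀ {x y} → x ∼ y → y ∼ x
  ∼-sym (mk∼ {w} Gw eq) = mk∼ (mul (neg one) Gw) (trans (x≈y+d⇒y≈x+εd eq)
    (+-congˡ (solve 3 (λ a b c → a :* (b :* c) := b :* (a :* c)) refl ε π w)))

  ∼-trans : ∀ {x y z} → x ∼ y → y ∼ z → x ∼ z
  ∼-trans (mk∼ {w} Gw eq) (mk∼ {v} Gv eq′) = mk∼ (add Gv Gw) (trans eq (trans (+-congʳ eq′)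
    (solve 4 (λ z p v w → z :+ p :* v :+ p :* w := z :+ p :* (v :+ w)) refl _ π v w)))

  infixl 6 _+′_
  _+′_ : Elem → Elem → Elem
  (x , Gx) +′ (y , Gy) = x + y , add Gx Gy

  infixl 7 _*′_
  _*′_ : Elem → Elem → Elem
  (x , Gx) *′ (y , Gy) = x * y , mul Gx Gy

  -′_ : Elem → Elem
  -′ (x , Gx) = - x , neg Gx

  +′-cong : ∀ {x x′ y y′} → x ∼ x′ → y ∼ y′ → x +′ y ∼ x′ +′ y′
  +′-cong (mk∼ {w} Gw eq) (mk∼ {v} Gv eq′) = mk∼ (add Gw Gv) (trans (+-cong eq eq′)
    (solve 5 (λ x y p w v → (x :+ p :* w) :+ (y :+ p :* v) := (x :+ y) :+ p :* (w :+ v)) refl _ _ π w v))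

  *′-cong : ∀ {x x′ y y′} → x ∼ x′ → y ∼ y′ → x *′ y ∼ x′ *′ y′
  *′-cong {_} {x′ , Gx′} {y , Gy} {y′ , _} (mk∼ {w} Gw eq) (mk∼ {v} Gv eq′) = mk∼ (add (mul Gx′ Gv) (mul Gw Gy)) (begin
    _ * y                                ≈⟨ *-congʳ eq ⟩
    (x′ + π * w) * y                     ≈⟨ distribʳ y x′ _ ⟩
    x′ * y + π * w * y                   ≈⟨ +-congʳ (*-congˡ eq′) ⟩
    x′ * (y′ + π * v) + π * w * y
     
       ≈⟨ solve 6 (λ x y p v w z → x :* (y :+ p :* v) :+ p :* w :* z := x :* y :+ p :* (x :* v :+ w :* z)) refl
            x′ y′ π v w y ⟩
    x′ * y′ + π * (x′ * v + w * y)       ∎)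

  -′-cong : ∀ {x x′} → x ∼ x′ → -′ x ∼ -′ x′
  -′-cong {x , _} {x′ , _} (mk∼ {w} Gw eq) = mk∼ (mul (neg one) Gw) (begin
    - x                          ≈⟨ -1*x≈-x x ⟨
    ε * x                        ≈⟨ *-congˡ eq ⟩
    ε * (x′ + π * w)             ≈⟨ solve 4 (λ e x p w → e :* (x :+ p :* w) := e :* x :+ p :* (e :* w)) refl ε x′ π w ⟩
    ε * x′ + π * (ε * w)         ≈⟨ +-congʳ (-1*x≈-x x′) ⟩
    - x′ + π * (ε * w)           ∎)

  quotientRing : CommutativeRing (c ⊔ ℓ) (c ⊔ ℓ)
  quotientRing = record
    { Carrier = Elem
    ; _≈_ = _∼_
    ; _+_ = _+′_
    ; _*_ = _*′_
    ; -_  = -′_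
    ; 0#  = 0# , gen-zero
    ; 1#  = 1# , one
    ; isCommutativeRing = record
      { isRing = record
        { +-isAbelianGroup = record
          { isGroup = record
            { isMonoid = record
              { isSemigroup = record
                { isMagma = record
                  { isEquivalence = record
                    { refl = ≈⇒∼ refl ; sym = ∼-sym ; trans = ∼-trans }
                  ; ∙-cong = +′-cong
                  }
                ; assoc = λ x y z → ≈⇒∼ (+-assoc _ _ _)
                }
              ; identity = (λ x → ≈⇒∼ (+-identityˡ _)) , (λ x → ≈⇒∼ (+-identityʳ _))
              }
            ; inverse = (λ x → ≈⇒∼ (-‿inverseˡ _)) , (λ x → ≈⇒∼ (-‿inverseʳ _))
            ; ⁻¹-cong = -′-cong
            }
          ; comm = λ x y → ≈⇒∼ (+-comm _ _)
          }
        ; *-cong = *′-cong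
        ; *-assoc = λ x y z → ≈⇒∼ (*-assoc _ _ _)
        ; *-identity = (λ x → ≈⇒∼ (*-identityˡ _)) , (λ x → ≈⇒∼ (*-identityʳ _))
        ; distrib = (λ x y z → ≈⇒∼ (distribˡ _ _ _)) , (λ x y z → ≈⇒∼ (distribʳ _ _ _))
        }
      ; *-comm = λ x y → ≈⇒∼ (*-comm _ _)
      }
    }

  private
    module Q where
      open CommutativeRing quotientRing public
      open RingLemmas quotientRing public

  proj-^ : ∀ x m → proj₁ (x Q.^ m) ≈ proj₁ x ^ m
  proj-^ x zero    = refl
  proj-^ x (suc m) = *-congˡ (proj-^ x m)

  proj-× : ∀ m x → proj₁ (m Q.× x) ≈ m × proj₁ x
  proj-× zero    x = refl
  proj-× (suc m) x = +-congˡ (proj-× m x)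

-- Exponents from self-conjugacy

prime-part : ∀ {p} → Prime p → ∀ n → n ≢ 0 → ∃[ b ] ∃[ n′ ] n ≡ n′ ℕ.* p ℕ.^ b ∧ ¬ p ∣ n′
prime-part {p} p-prime = <-rec _ step
  where
  step : ∀ n → (∀ {m} → m ℕ.< n → m ≢ 0 → ∃[ b ] ∃[ n′ ] m ≡ n′ ℕ.* p ℕ.^ b ∧ ¬ p ∣ n′) →
    n ≢ 0 → ∃[ b ] ∃[ n′ ] n ≡ n′ ℕ.* p ℕ.^ b ∧ ¬ p ∣ n′
  step n rec n≢0 with p ∣? n
  ... | no p∤n = 0 , n , ≡.sym (ℕ.*-identityʳ n) , p∤n
  ... | yes (divides zero n≡0) = ⊥-elim (n≢0 n≡0)
  ... | yes (divides m@(suc _) n≡mp) with rec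
        (≡.subst (m ℕ.<_) (≡.sym n≡mp) (ℕ.m<m*n m p (ℕ.nonTrivial⇒n>1 p {{prime⇒nonTrivial p-prime}})))
        (λ ())
  ...   | b , n′ , m≡ , p∤n′ = suc b , n′ , ≡.trans n≡mp (≡.trans (≡.cong (ℕ._* p) m≡) (lem n′ (p ℕ.^ b) p)) , p∤n′
    where
    lem : ∀ x y z → x ℕ.* y ℕ.* z ≡ x ℕ.* (z ℕ.* y)
    lem = solve-∀

coprime-^ : ∀ {p n} → Coprime p n → ∀ a → Coprime (p ℕ.^ a) n
coprime-^ cop zero    (d∣1 , _) = ∣1⇒≡1 d∣1
coprime-^ {p} cop (suc a) (d∣ , d∣n) = coprime-^ cop a
  (coprime-divisor (λ (e∣d , e∣p) → cop (e∣p , ∣-trans e∣d d∣n)) d∣ , d∣n)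

-- An odd power of -1 is -1. The induction uses x² (t + 1) = (x + 1)(x - 1) + (x² t + 1).
1+x∣x^odd+1 : ∀ x .{{_ : NonZero x}} m → x ℕ.+ 1 ∣ x ℕ.^ suc (m ℕ.+ m) ℕ.+ 1
1+x∣x^odd+1 x zero    = ∣-reflexive (≡.cong (ℕ._+ 1) (≡.sym (ℕ.*-identityʳ x)))
1+x∣x^odd+1 x@(suc y) (suc m) = ∣m+n∣m⇒∣n
  (≡.subst (x ℕ.+ 1 ∣_) identity (∣n⇒∣m*n (x ℕ.* x) (1+x∣x^odd+1 x m))) (m∣m*n y)
  where
  lem : ∀ y t → (suc y ℕ.* suc y) ℕ.* (t ℕ.+ 1) ≡ (suc y ℕ.+ 1) ℕ.* y ℕ.+ (suc y ℕ.* (suc y ℕ.* t) ℕ.+ 1)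
  lem = solve-∀
  identity : (x ℕ.* x) ℕ.* (x ℕ.^ suc (m ℕ.+ m) ℕ.+ 1) ≡ (x ℕ.+ 1) ℕ.* y ℕ.+ (x ℕ.^ suc (suc m ℕ.+ suc m) ℕ.+ 1)
  identity = ≡.trans (lem y (x ℕ.^ suc (m ℕ.+ m)))
    (≡.cong (λ z → (x ℕ.+ 1) ℕ.* y ℕ.+ (x ℕ.^ suc (suc z) ℕ.+ 1)) (≡.sym (ℕ.+-suc m m)))

-- Handles j = 0 in self-conjugacy, where multiplying the exponent achieves nothing: it is replaced
-- by j = 1. If p is even, coprimality forces N = 1; if p is odd, 2 divides p + 1.
∣2⇒∣p+1 : ∀ {p N} → Coprime p N → N ∣ 2 → N ∣ p ℕ.+ 1
∣2⇒∣p+1 {p} {N} cop N∣2 with 2 ∣? p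
... | yes 2∣p = ≡.subst (_∣ p ℕ.+ 1) (≡.sym (cop (∣-trans N∣2 2∣p , ∣-refl))) (1∣ _)
... | no 2∤p = ∣-trans N∣2 (odd p 2∤p)
  where
  odd : ∀ m → ¬ 2 ∣ m → 2 ∣ m ℕ.+ 1
  odd zero          2∤m = ⊥-elim (2∤m (2 ∣0))
  odd (suc zero)    2∤m = ∣-refl
  odd (suc (suc m)) 2∤m = ∣m∣n⇒∣m+n ∣-refl (odd m λ 2∣m → 2∤m (∣m∣n⇒∣m+n ∣-refl 2∣m))

large-exponent : ∀ {p N} → Prime p → Coprime p N → ∃[ j ] N ∣ p ℕ.^ j ℕ.+ 1 →
  ∀ B → ∃[ j ] suc B ℕ.≤ j ∧ N ∣ p ℕ.^ j ℕ.+ 1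
large-exponent {p} {N} p-prime cop (j₀ , N∣j₀) B = multiple j₀ N∣j₀
  where
  multiple⁺ : ∀ j → N ∣ p ℕ.^ suc j ℕ.+ 1 → ∃[ j′ ] suc B ℕ.≤ j′ ∧ N ∣ p ℕ.^ j′ ℕ.+ 1
  -- 2B + 1 is odd, which preserves the residue -1, and large enough to push the exponent past B.
  multiple⁺ j N∣ = suc j ℕ.* suc (B ℕ.+ B) ,
    ℕ.≤-trans (s≤s (ℕ.m≤m+n B B)) (ℕ.m≤m+n (suc (B ℕ.+ B)) _) ,
    ∣-trans N∣ (≡.subst (λ z → p ℕ.^ suc j ℕ.+ 1 ∣ z ℕ.+ 1) (ℕ.^-*-assoc p (suc j) (suc (B ℕ.+ B)))
      (1+x∣x^odd+1 (p ℕ.^ suc j) {{ℕ.m^n≢0 p (suc j) {{prime⇒nonZero p-prime}}}} B))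
  multiple : ∀ j → N ∣ p ℕ.^ j ℕ.+ 1 → ∃[ j′ ] suc B ℕ.≤ j′ ∧ N ∣ p ℕ.^ j′ ℕ.+ 1
  multiple (suc j) N∣  = multiple⁺ j N∣
  multiple zero    N∣2 = multiple⁺ 0
    (≡.subst (λ z → N ∣ z ℕ.+ 1) (≡.sym (ℕ.*-identityʳ p)) (∣2⇒∣p+1 cop N∣2))

-- With q = p^j: `q+1≡` makes the q-th power invert ξ modulo s, `q+1≡he` makes it invert h-th roots
-- of unity, `qq≡` makes the q²-th power fix ξ modulo s, and `P∣q` confines q²-th powers to
-- exponents divisible by P. The bound in `q≡` serves `zero-φφ`.
record Exponents (p n h : ℕ) : Set where
  field
    b n′ j k l m e : ℕ
    n≡      : n ≡ n′ ℕ.* p ℕ.^ suc b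
    coprime : Coprime (p ℕ.^ suc b) n′
    qq≡     : (p ℕ.^ j) ℕ.* (p ℕ.^ j) ≡ suc (n′ ℕ.* k)
    q+1≡    : suc (p ℕ.^ j) ≡ n′ ℕ.* l
    q+1≡he  : suc (p ℕ.^ j) ≡ h ℕ.* e
    q≡      : p ℕ.^ j ≡ suc (suc m)
    P∣q     : p ℕ.^ suc b ∣ p ℕ.^ j

exponents : ∀ {p n h} → Prime p → n ≢ 0 → p ∣ n → ¬ p ∣ h → SelfConjugate p (lcm n h) → Exponents p n h
exponents {p} {n} {h} p-prime n≢0 p∣n p∤h (a , N , lcm≡ , cop , conj) with prime-part p-prime n n≢0
... | zero , n′ , n≡ , p∤n′ = ⊥-elim (p∤n′ (≡.subst (p ∣_) (≡.trans n≡ (ℕ.*-identityʳ n′)) p∣n))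
... | suc b , n′ , n≡ , p∤n′ with large-exponent p-prime cop conj b
...   | j , b<j , N∣ = record
  { b = b ; n′ = n′ ; j = j ; k = l ℕ.* ℕ.pred q ; l = l ; m = ℕ.pred (ℕ.pred q) ; e = quotient h∣q+1
  ; n≡ = n≡
  ; coprime = coprime-^ (prime∤⇒coprime p-prime p∤n′) (suc b)
  ; qq≡ = qq≡
  ; q+1≡ = q+1≡
  ; q+1≡he = ≡.trans (_∣_.equality h∣q+1) (ℕ.*-comm _ h)
  ; q≡ = ≡.sym (≡.trans (≡.cong suc (ℕ.suc-pred (ℕ.pred q) {{ℕ.>-nonZero (ℕ.pred-mono-≤ 2≤q)}})) suc-pred-q)
  ; P∣q = m≤n⇒m^k∣n^k b<j
  }
  where
  q = p ℕ.^ j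
  1<p : 1 ℕ.< p
  1<p = ℕ.nonTrivial⇒n>1 p {{prime⇒nonTrivial p-prime}}
  instance
    p≢0 : NonZero p
    p≢0 = prime⇒nonZero p-prime
  m≤n⇒m^k∣n^k : ∀ {i k} → i ℕ.≤ k → p ℕ.^ i ∣ p ℕ.^ k
  m≤n⇒m^k∣n^k {i} {k} i≤k = divides (p ℕ.^ (k ∸ i))
    (≡.trans (≡.cong (p ℕ.^_) (≡.sym (ℕ.m∸n+n≡m i≤k))) (ℕ.^-distribˡ-+-* p (k ∸ i) i))
  2≤q : 2 ℕ.≤ q
  2≤q = ℕ.≤-trans 1<p (∣⇒≤ {{ℕ.m^n≢0 p j}}
    (≡.subst (_∣ q) (ℕ.*-identityʳ p) (m≤n⇒m^k∣n^k (ℕ.≤-trans (s≤s z≤n) b<j))))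
  suc-pred-q : suc (ℕ.pred q) ≡ q
  suc-pred-q = ℕ.suc-pred q {{ℕ.m^n≢0 p j}}
  N∣q+1 : N ∣ suc q
  N∣q+1 = ≡.subst (N ∣_) (ℕ.+-comm q 1) N∣
  -- The lcm is p^a N, so a divisor of it that is prime to p divides N.
  prime-to-p∣N : ∀ {d} → ¬ p ∣ d → d ∣ lcm n h → d ∣ N
  prime-to-p∣N p∤d d∣lcm = coprime-divisor (Coprime.sym (coprime-^ (prime∤⇒coprime p-prime p∤d) a)) (≡.subst (_ ∣_) lcm≡ d∣lcm)
  n′∣q+1 : n′ ∣ suc q
  n′∣q+1 = ∣-trans (prime-to-p∣N p∤n′ (∣-trans (divides (p ℕ.^ suc b) (≡.trans n≡ (ℕ.*-comm n′ _))) (m∣lcm[m,n] n h))) N∣q+1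
  h∣q+1 : h ∣ suc q
  h∣q+1 = ∣-trans (prime-to-p∣N p∤h (n∣lcm[m,n] n h)) N∣q+1
  l = quotient n′∣q+1
  q+1≡ : suc q ≡ n′ ℕ.* l
  q+1≡ = ≡.trans (_∣_.equality n′∣q+1) (ℕ.*-comm _ n′)
  -- q² - 1 = (q + 1)(q - 1), whence k = l (q - 1).
  qq≡ : q ℕ.* q ≡ suc (n′ ℕ.* (l ℕ.* ℕ.pred q))
  qq≡ = begin
    q ℕ.* q                           ≡⟨ ≡.cong (λ z → z ℕ.* z) suc-pred-q ⟨
    suc y ℕ.* suc y                   ≡⟨ lem y ⟩
    suc (suc (suc y) ℕ.* y)           ≡⟨ ≡.cong (λ z → suc (suc z ℕ.* y)) suc-pred-q ⟩
    suc (suc q ℕ.* y)                 ≡⟨ ≡.cong (λ z → suc (z ℕ.* y)) q+1≡ ⟩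
    suc (n′ ℕ.* l ℕ.* y)              ≡⟨ ≡.cong suc (ℕ.*-assoc n′ l y) ⟩
    suc (n′ ℕ.* (l ℕ.* y))            ∎
    where
    open ≡.≡-Reasoning
    y = ℕ.pred q
    lem : ∀ y → suc y ℕ.* suc y ≡ suc (suc (suc y) ℕ.* y)
    lem = solve-∀

-- Back to characteristic zero

module PowerDifference {c ℓ} (R : CommutativeRing c ℓ) where
  open CommutativeRing R
  open RingLemmas R
  open import Relation.Binary.Reasoning.Setoid setoid

  -- The quotient (x^m - y^m) / (x - y), that is, the sum of all monomials of degree m - 1 in x and
  -- y.
  homogeneous : Carrier → Carrier → ℕ → Carrier
  homogeneous x y zero    = 0#
  homogeneous x y (suc m) = x ^ m + y * homogeneous x y m

  power-difference : ∀ x y m → x ^ m ≈ y ^ m + (x + ε * y) * homogeneous x y m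
  power-difference x y zero    = sym (trans (+-congˡ (zeroʳ _)) (+-identityʳ 1#))
  power-difference x y (suc m) = sym (begin
    y * y ^ m + (x + ε * y) * (x ^ m + y * B)
      ≈⟨ solve 6 (λ x y e xm ym B → y :* ym :+ (x :+ e :* y) :* (xm :+ y :* B)
           := x :* xm :+ (y :* (ym :+ (x :+ e :* y) :* B) :+ e :* (y :* xm))) refl x y ε (x ^ m) (y ^ m) B ⟩
    x * x ^ m + (y * (y ^ m + (x + ε * y) * B) + ε * (y * x ^ m))
      ≈⟨ +-congˡ (+-congʳ (*-congˡ (power-difference x y m))) ⟨
    x * x ^ m + (y * x ^ m + ε * (y * x ^ m))     ≈⟨ +-congˡ (x+εx≈0 _) ⟩
    x * x ^ m + 0#                                ≈⟨ +-identityʳ _ ⟩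
    x * x ^ m                                     ∎)
    where B = homogeneous x y m

  -- On the diagonal the quotient becomes the derivative of x^m; the extra factor y avoids the
  -- exponent m - 1.
  homogeneous-diagonal : ∀ {x y} → x ≈ y → ∀ m → y * homogeneous x y m ≈ m × y ^ m
  homogeneous-diagonal x≈y zero = zeroʳ _
  homogeneous-diagonal {x} {y} x≈y (suc m) = begin
    y * (x ^ m + y * homogeneous x y m)        ≈⟨ distribˡ y _ _ ⟩
    y * x ^ m + y * (y * homogeneous x y m)    ≈⟨ +-cong (*-congˡ (^-congˡ m x≈y)) (*-congˡ (homogeneous-diagonal x≈y m)) ⟩
    y * y ^ m + y * (m × y ^ m)                ≈⟨ +-congˡ (×-comm-* m y _) ⟩
    y ^ suc m + m × y ^ suc m                  ∎

module Lifting {c ℓ} (R : CommutativeRing c ℓ) (domain : IsChar0Domain R) {p : ℕ} (p-prime : Prime p)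
  (L : List (CommutativeRing.Carrier R)) (h-1 : ℕ)
  (roots : All (RingLemmas.IsRootOfUnity R (suc h-1)) L)
  (p∤h : ¬ p ∣ suc h-1) where
  open CommutativeRing R
  open RingLemmas R
  open GeneratedSubring R
  open QuotientRing R L (p × 1#) public
  open IsChar0Domain domain
  private
    module Q where
      open CommutativeRing quotientRing public
      open RingLemmas quotientRing public
      open PowerDifference quotientRing public
  open PowerDifference R

  h : ℕ
  h = suc h-1

  natR≈× : ∀ k → natR R k ≈ k × 1#
  natR≈× zero    = refl
  natR≈× (suc k) = +-congˡ (natR≈× k)

  ×-char0 : ∀ k → k × 1# ≈ 0# → k ≡ 0
  ×-char0 k eq = char0 k (trans (natR≈× k) eq)

  multiple∼0 : ∀ X {w} → Generated L w → proj₁ X ≈ (p × 1#) * w → X ∼ Q.0#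
  multiple∼0 X Gw eq = mk∼ Gw (trans eq (sym (+-identityˡ _)))

  p×1∼0 : p Q.× Q.1# ∼ Q.0#
  p×1∼0 = multiple∼0 (p Q.× Q.1#) one (trans (proj-× p Q.1#) (sym (*-identityʳ _)))

  1≁0 : ¬ Q.1# ∼ Q.0#
  1≁0 (mk∼ Gw eq) = p-nonunit ×-char0 (ℕ.nonTrivial⇒n>1 p {{prime⇒nonTrivial p-prime}}) L h-1 roots
    (_ , Gw , trans eq (+-identityˡ _))

  proj-homogeneous : ∀ X Y m → proj₁ (Q.homogeneous X Y m) ≈ homogeneous (proj₁ X) (proj₁ Y) m
  proj-homogeneous X Y zero    = refl
  proj-homogeneous X Y (suc m) = +-cong (proj-^ X m) (*-congˡ (proj-homogeneous X Y m))

  -- In the domain, x^h = y^h leaves x = y or a vanishing cofactor. Modulo p, where x and y agree, y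
  -- times the cofactor is h y^h = h; its vanishing together with p = 0 and p prime to h would give
  -- 1 = 0 in the quotient.
  root-lift : ∀ {X Y} → X ∼ Y → proj₁ X ^ h ≈ 1# → proj₁ Y ^ h ≈ 1# → proj₁ X ≈ proj₁ Y
  root-lift {X} {Y} X∼Y x^h≈1 y^h≈1 =
    [ x+εy≈0⇒x≈y , (λ B≈0 → ⊥-elim (1≁0 (Q.coprime-×-zero Q.1# (prime∤⇒coprime p-prime p∤h) p×1∼0 (h×1∼0 B≈0)))) ]′
      (noZeroDivisors (x + ε * y) (homogeneous x y h) product≈0)
    where
    x = proj₁ X
    y = proj₁ Y
    product≈0 : (x + ε * y) * homogeneous x y h ≈ 0#
    product≈0 = sym (+-cancelˡ 1# _ _ (begin
      1# + 0#                                      ≈⟨ +-identityʳ 1# ⟩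
      1#                                           ≈⟨ x^h≈1 ⟨
      x ^ h                                        ≈⟨ power-difference x y h ⟩
      y ^ h + (x + ε * y) * homogeneous x y h      ≈⟨ +-congʳ y^h≈1 ⟩
      1# + (x + ε * y) * homogeneous x y h         ∎))
      where
      open import Relation.Binary.Reasoning.Setoid setoid
    h×1∼0 : homogeneous x y h ≈ 0# → h Q.× Q.1# ∼ Q.0#
    h×1∼0 B≈0 = begin
      h Q.× Q.1#                        ≈⟨ Q.×-congʳ h {Y Q.^ h} {Q.1#} (≈⇒∼ (trans (proj-^ Y h) y^h≈1)) ⟨
      h Q.× Y Q.^ h                     ≈⟨ Q.homogeneous-diagonal X∼Y h ⟨
      Y Q.* Q.homogeneous X Y h         ≈⟨ Q.*-zeroʳ Y (≈⇒∼ {Q.homogeneous X Y h} {Q.0#} (trans (proj-homogeneous X Y h) B≈0)) ⟩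
      Q.0#                              ∎
      where
      open import Relation.Binary.Reasoning.Setoid Q.setoid

  open SumBelow R
  private
    module QS = SumBelow quotientRing

  proj-sumBelow : ∀ m F → proj₁ (QS.sumBelow m F) ≈ sumBelow m (λ i → proj₁ (F i))
  proj-sumBelow zero    F = refl
  proj-sumBelow (suc m) F = +-congˡ (proj-sumBelow m (λ i → F (suc i)))

  module _ (j : ℕ) (inverse : All (λ a → a * a ^ (p ℕ.^ j) ≈ 1#) L) where
    open CharP quotientRing p-prime j p×1∼0

    φφ-inverse : ∀ x → x * x ^ q ≈ 1# → (x ^ q) ^ q ≈ x
    φφ-inverse x eq = begin
      y ^ q               ≈⟨ *-identityˡ _ ⟨
      1# * y ^ q          ≈⟨ *-congʳ eq ⟨
      x * y * y ^ q       ≈⟨ *-assoc x y _ ⟩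
      x * (y * y ^ q)     ≈⟨ *-congˡ (trans (sym (^-distrib-* x y q)) (trans (^-congˡ q eq) (1^n≈1 q))) ⟩
      x * 1#              ≈⟨ *-identityʳ x ⟩
      x                   ∎
      where
      open import Relation.Binary.Reasoning.Setoid setoid
      y = x ^ q

    -- On generators the identity holds exactly, because raising to the q-th power inverts them; it
    -- spreads to sums only modulo p, where φ is additive.
    φφ∼id : ∀ {x} (Gx : Generated L x) → φ (φ (x , Gx)) ∼ (x , Gx)
    φφ∼id (gen {x} x∈L) = ≈⇒∼ (trans (proj-^ (φ X) q) (trans (^-congˡ q (proj-^ X q)) (φφ-inverse x (All.lookup inverse x∈L))))
      where X = x , gen x∈L
    φφ∼id one         = Q.trans (φ-cong (Q.1^n≈1 q)) (Q.1^n≈1 q)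
    φφ∼id (add Gx Gy) = Q.trans (φφ-+ _ _) (Q.+-cong (φφ∼id Gx) (φφ∼id Gy))
    φφ∼id (mul Gx Gy) = Q.trans (φφ-* _ _) (Q.*-cong (φφ∼id Gx) (φφ∼id Gy))
    φφ∼id (neg {x} Gx) = begin
      φ (φ (Q.- X))                ≈⟨ φφ-cong (Q.-1*x≈-x X) ⟨
      φ (φ (Q.ε Q.* X))            ≈⟨ φφ-* Q.ε X ⟩
      φ (φ Q.ε) Q.* φ (φ X)        ≈⟨ Q.*-cong (Q.trans (φ-cong ε^q) ε^q) (φφ∼id Gx) ⟩
      Q.ε Q.* X                    ≈⟨ Q.-1*x≈-x X ⟩
      Q.- X                        ∎
      where
      open import Relation.Binary.Reasoning.Setoid Q.setoid
      X = x , Gx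
      ε^q = Frobenius.ε^q≈ε quotientRing p-prime p×1∼0 j
    φφ∼id (resp {x} {y} eq Gx) = Q.trans (φφ-cong {y , resp eq Gx} {x , Gx} (≈⇒∼ (sym eq))) (Q.trans (φφ∼id Gx) (≈⇒∼ eq))

-- Autocorrelation of the first row

module FirstRow {c ℓ} (R : CommutativeRing c ℓ) (n h-1 : ℕ) .{{n≢0 : NonZero n}} (bh : BH R n (suc h-1)) where
  open CommutativeRing R
  open RingLemmas R
  open SumBelow R
  open BH bh
  open import Relation.Binary.Reasoning.Setoid setoid

  residue : ℕ → Fin n
  residue i = fromℕ< (m%n<n i n)

  toℕ-residue : ∀ i → toℕ (residue i) ≡ i % n
  toℕ-residue i = Fin.toℕ-fromℕ< _

  residue-cong : ∀ {i k} → i % n ≡ k % n → residue i ≡ residue k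
  residue-cong {i} {k} eq = Fin.toℕ-injective (≡.trans (toℕ-residue i) (≡.trans eq (≡.sym (toℕ-residue k))))

  residue-toℕ : ∀ g → residue (toℕ g) ≡ g
  residue-toℕ g = Fin.toℕ-injective (≡.trans (toℕ-residue (toℕ g)) (m<n⇒m%n≡m (Fin.toℕ<n g)))

  residue-⊕ : ∀ i k → residue i ⊕ residue k ≡ residue (i ℕ.+ k)
  residue-⊕ i k = residue-cong (≡.trans
    (≡.cong₂ (λ x y → (x ℕ.+ y) % n) (toℕ-residue i) (toℕ-residue k))
    (≡.sym (%-distribˡ-+ i k n)))

  a : ℕ → Carrier
  a i = H (residue 0) (residue i)

  pow≈^ : ∀ x m → pow R x m ≈ x ^ m
  pow≈^ x zero    = refl
  pow≈^ x (suc m) = *-congˡ (pow≈^ x m)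

  a-root : ∀ i → a i ^ suc h-1 ≈ 1#
  a-root i = trans (sym (pow≈^ (a i) (suc h-1))) (root _ _)

  a-cong : ∀ {i k} → i % n ≡ k % n → a i ≈ a k
  a-cong eq = reflexive (≡.cong (H (residue 0)) (residue-cong eq))

  a-periodic : ∀ i → a (n ℕ.+ i) ≈ a i
  a-periodic i = a-cong (≡.trans (≡.cong (_% n) (ℕ.+-comm n i)) ([m+n]%n≡m%n i n))

  opposite : ℕ → ℕ
  opposite i = n ∸ i % n

  n∣opposite+ : ∀ i → n ∣ opposite i ℕ.+ i
  n∣opposite+ i = n∣n∸[k%n]+k n i

  -- Adding i to both indices carries row -i to row 0, so orthogonality of rows becomes a statement
  -- about shifts of the single sequence a.
  row-shift : ∀ i g → H (residue (opposite i)) g ≈ a (toℕ g ℕ.+ i)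
  row-shift i g = begin
    H (residue (opposite i)) g                                   ≈⟨ invariant _ _ (residue i) ⟨
    H (residue (opposite i) ⊕ residue i) (g ⊕ residue i)         ≈⟨ reflexive (≡.cong₂ H row column) ⟩
    a (toℕ g ℕ.+ i)                                              ∎
    where
    row : residue (opposite i) ⊕ residue i ≡ residue 0
    row = ≡.trans (residue-⊕ (opposite i) i)
      (residue-cong (≡.trans (n∣m⇒m%n≡0 _ n (n∣opposite+ i)) (≡.sym (m<n⇒m%n≡m (ℕ.>-nonZero⁻¹ n)))))
    column : g ⊕ residue i ≡ residue (toℕ g ℕ.+ i)
    column = ≡.trans (≡.cong (_⊕ residue i) (≡.sym (residue-toℕ g))) (residue-⊕ (toℕ g) i)

  sumFin≈sumBelow : ∀ {m} (f : Fin m → Carrier) (f′ : ℕ → Carrier) → (∀ i → f i ≈ f′ (toℕ i)) →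
    sumFin R f ≈ sumBelow m f′
  sumFin≈sumBelow {zero}  f f′ eq = refl
  sumFin≈sumBelow {suc m} f f′ eq = +-cong (eq Fin.zero) (sumFin≈sumBelow (λ i → f (Fin.suc i)) (λ i → f′ (suc i)) (λ i → eq (Fin.suc i)))

  correlation : ℕ → Carrier
  correlation i = sumBelow n (λ g → a g ^ h-1 * a (g ℕ.+ i))

  row₀ : ∀ g → pow R (H (residue 0) g) h-1 ≈ a (toℕ g) ^ h-1
  row₀ g = trans (pow≈^ _ h-1) (^-congˡ h-1 (reflexive (≡.cong (H (residue 0)) (≡.sym (residue-toℕ g)))))

  correlation-off : ∀ i → ¬ n ∣ i → correlation i ≈ 0#
  correlation-off i n∤i = trans
    (sym (sumFin≈sumBelow _ _ λ g → trans (*-cong (row-shift i g) (row₀ g)) (*-comm _ _)))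
    (orth-off (residue (opposite i)) (residue 0) λ eq → n∤i
      (∣m+n∣m⇒∣n (n∣opposite+ i) (m%n≡0⇒n∣m (opposite i) n
        (≡.trans (≡.sym (toℕ-residue (opposite i))) (≡.trans (≡.cong toℕ eq) (≡.trans (toℕ-residue 0) (m<n⇒m%n≡m (ℕ.>-nonZero⁻¹ n))))))))

  sumBelow-× : ∀ m x → sumBelow m (λ _ → x) ≈ m × x
  sumBelow-× zero    x = refl
  sumBelow-× (suc m) x = +-congˡ (sumBelow-× m x)

  correlation-on : ∀ i → (∀ g → a (g ℕ.+ i) ≈ a g) → correlation i ≈ n × 1#
  correlation-on i eq = begin
    sumBelow n (λ g → a g ^ h-1 * a (g ℕ.+ i))  ≈⟨ sumBelow-cong n (λ g _ → trans (*-congˡ (eq g)) (trans (*-comm _ _) (a-root g))) ⟩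
    sumBelow n (λ _ → 1#)                       ≈⟨ sumBelow-× n 1# ⟩
    n × 1#                                      ∎

  correlation-values : ∀ i → correlation i ≈ 0# ⊎ correlation i ≈ n × 1#
  correlation-values i with n ∣? i
  ... | no n∤i = inj₁ (correlation-off i n∤i)
  ... | yes (divides t i≡tn) = inj₂ (correlation-on i λ g →
    a-cong (≡.trans (≡.cong (λ z → (g ℕ.+ z) % n) i≡tn) ([m+kn]%n≡m%n g t n)))

-- Invariance under n/p contradicts orthogonality

module Contradiction {c ℓ} (R : CommutativeRing c ℓ) (domain : IsChar0Domain R) (n h-1 : ℕ) .{{_ : NonZero n}}
  (bh : BH R n (suc h-1)) {p : ℕ} (p-prime : Prime p) (p∣n : p ∣ n) (conj : SelfConjugate p (lcm n (suc h-1)))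
  (p∤h : ¬ p ∣ suc h-1) where
  open CommutativeRing R
  open RingLemmas R
  open GeneratedSubring R
  open FirstRow R n h-1 bh
  h = suc h-1
  n≢0 : n ≢ 0
  n≢0 = ℕ.≢-nonZero⁻¹ n
  open Exponents (exponents p-prime n≢0 p∣n p∤h conj)
  instance
    p≢0 : NonZero p
    p≢0 = prime⇒nonZero p-prime
    n′≢0 : NonZero n′
    n′≢0 = ℕ.≢-nonZero λ n′≡0 → n≢0 (≡.trans n≡ (≡.cong (ℕ._* p ℕ.^ suc b) n′≡0))
  q = p ℕ.^ j
  N = n′ ℕ.* p ℕ.^ b

  L : List Carrier
  L = tabulate {n = n} (λ g → a (toℕ g))

  n∤N : ¬ n ∣ N
  n∤N n∣N = ℕ.<⇒≱
    (≡.subst (N ℕ.<_) (≡.sym n≡) (ℕ.*-monoʳ-< n′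
      (≡.subst (p ℕ.^ b ℕ.<_) (ℕ.*-comm (p ℕ.^ b) p) (ℕ.m<m*n (p ℕ.^ b) p {{ℕ.m^n≢0 p b}} 1<p))))
    (∣⇒≤ {{ℕ.m*n≢0 n′ (p ℕ.^ b) {{n′≢0}} {{ℕ.m^n≢0 p b}}}} n∣N)
    where
    1<p : 1 ℕ.< p
    1<p = ℕ.nonTrivial⇒n>1 p {{prime⇒nonTrivial p-prime}}

  roots : All (IsRootOfUnity h) L
  roots = All.tabulate⁺ (λ g → a-root (toℕ g))

  a*a^q≈1 : ∀ x → x ^ h ≈ 1# → x * x ^ q ≈ 1#
  a*a^q≈1 x x^h≈1 = trans (^-congʳ x q+1≡he) (trans (sym (^-assocʳ x h e)) (trans (^-congˡ e x^h≈1) (1^n≈1 e)))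

  open Lifting R domain p-prime L h-1 roots p∤h hiding (h)

  α : ℕ → Elem
  -- `L` lists only the entries at 0, ..., n - 1, so membership goes through the residue of i.
  α i = a i , resp (a-cong (≡.trans (≡.cong (_% n) (toℕ-residue i)) (m%n%n≡m%n i n))) (gen (∈-tabulate⁺ (residue i)))

  open CharP quotientRing p-prime j p×1∼0 using (φ)
  module QS = SumBelow quotientRing
  module Q where
    open CommutativeRing quotientRing public
    open RingLemmas quotientRing public

  open SumBelow R

  a^q≈a^[h-1] : ∀ i → a i ^ q ≈ a i ^ h-1
  a^q≈a^[h-1] i = begin
    x ^ q                    ≈⟨ *-identityʳ _ ⟨
    x ^ q * 1#               ≈⟨ *-congˡ (a-root i) ⟨
    x ^ q * (x * x ^ h-1)    ≈⟨ solve 3 (λ u x v → u :* (x :* v) := x :* u :* v) refl (x ^ q) x (x ^ h-1) ⟩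
    x * x ^ q * x ^ h-1      ≈⟨ *-congʳ (a*a^q≈1 x (a-root i)) ⟩
    1# * x ^ h-1             ≈⟨ *-identityˡ _ ⟩
    x ^ h-1                  ∎
    where
    open import Relation.Binary.Reasoning.Setoid setoid
    x = a i

  -- Both possible values 0 and n are multiples of p, with cofactors in the image of ℤ and hence in
  -- every generated subring.
  correlation-divisible : ∀ i → ∃[ w ] Generated L w ∧ correlation i ≈ (p × 1#) * w
  correlation-divisible i = [ off , on ]′ (correlation-values i)
    where
    off : correlation i ≈ 0# → ∃[ w ] Generated L w ∧ correlation i ≈ (p × 1#) * w
    off eq = 0# , gen-zero , trans eq (sym (zeroʳ _))
    on : correlation i ≈ n × 1# → ∃[ w ] Generated L w ∧ correlation i ≈ (p × 1#) * w
    on eq = quotient p∣n × 1# , gen-× (quotient p∣n) ,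
      trans eq (trans (×-congˡ (≡.trans (_∣_.equality p∣n) (ℕ.*-comm (quotient p∣n) p))) (×1-homo-* p (quotient p∣n)))

  correlation∼0 : ∀ i → QS.sumBelow n (λ g → φ (α g) Q.* α (g ℕ.+ i)) ∼ Q.0#
  correlation∼0 i = multiple∼0 _ (proj₁ (proj₂ (correlation-divisible i))) (trans
    (trans (proj-sumBelow n _)
      (sumBelow-cong n λ g _ → *-congʳ (trans (proj-^ (α g) q) (a^q≈a^[h-1] g))))
    (proj₂ (proj₂ (correlation-divisible i))))

  φφ≈id : ∀ X → φ (φ X) ∼ X
  φφ≈id X = φφ∼id j (All.map (λ {x} → a*a^q≈1 x) roots) (proj₂ X)

  α-periodic : ∀ i → α (n′ ℕ.* p ℕ.^ suc b ℕ.+ i) ∼ α i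
  α-periodic i = ≈⇒∼ (trans (reflexive (≡.cong (λ z → a (z ℕ.+ i)) (≡.sym n≡))) (a-periodic i))

  α*φα∼1 : ∀ i → α i Q.* φ (α i) ∼ Q.1#
  α*φα∼1 i = ≈⇒∼ (trans (*-congˡ (proj-^ (α i) q)) (a*a^q≈1 (a i) (a-root i)))

  correlation∼0′ : ∀ i → QS.sumBelow (n′ ℕ.* p ℕ.^ suc b) (λ g → φ (α g) Q.* α (g ℕ.+ i)) ∼ Q.0#
  correlation∼0′ i = ≡.subst (λ z → QS.sumBelow z (λ g → φ (α g) Q.* α (g ℕ.+ i)) ∼ Q.0#) n≡ (correlation∼0 i)

  α-invariant : ∀ i → α (N ℕ.+ i) ∼ α i
  α-invariant = Invariance.invariance quotientRing p-prime j p×1∼0 b n′ k l m qq≡ q+1≡ q≡ P∣q coprime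
    φφ≈id α α-periodic α*φα∼1 correlation∼0′

  a-invariant : ∀ g → a (g ℕ.+ N) ≈ a g
  a-invariant g = trans (reflexive (≡.cong a (ℕ.+-comm g N)))
    (root-lift {α (N ℕ.+ g)} {α g} (α-invariant g) (a-root _) (a-root g))

  contradiction : ⊥
  -- The autocorrelation at N = n/p equals n by invariance and 0 by orthogonality, as n does not
  -- divide N.
  contradiction = n≢0 (×-char0 n (trans (sym (correlation-on N a-invariant)) (correlation-off N n∤N)))

theorem3p3 : ∀ {c ℓ} (R : CommutativeRing c ℓ) → IsChar0Domain R →
    (n h : ℕ) .{{_ : NonZero n}} → NonZero h →
    BH R n h →
    ∀ p → Prime p → p ∣ n → SelfConjugate p (lcm n h) → p ∣ h
theorem3p3 R domain n zero ()
theorem3p3 R domain n h@(suc h-1) _ bh p p-prime p∣n conj with p ∣? h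
... | yes p∣h = p∣h
... | no p∤h = ⊥-elim (Contradiction.contradiction R domain n h-1 bh p-prime p∣n conj p∤h)
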